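{- Let $H$ be a graph and let $\mathcal{F}$ be the class of all (finite) graphs that do not contain $H$ as a minor. Then $\operatorname{ad}(\mathcal{F}) \leq 2$.
   Context: All graphs are finite. For a graph $G$ and $x,y\in V(G)$, $d_G(x,y)$ is the minimum number of edges of a path in $G$ between $x$ and $y$. For a nonnegative integer $n$, an $n$-dimensional control function for a class $\mathcal{F}$ of graphs is a function $f:\mathbb{R}^+\to\mathbb{R}^+$ such that for every $G\in\mathcal{F}$ and every real $r>0$ there exist collections $\mathcal{U}_1,\dots,\mathcal{U}_{n+1}$ of subsets of $V(G)$ with $\bigcup_{i}\bigcup_{U\in\mathcal{U}_i}U\supseteq V(G)$, such that for each $i$, whenever $U\neq U'$ are in $\mathcal{U}_i$ and $x\in U$, $x'\in U'$, we have $d_G(x,x')>r$, and whenever $x,x'$ lie in a common $U\in\mathcal{U}_i$ we have $d_G(x,x')\le f(r)$. The asymptotic dimension $\operatorname{ad}(\mathcal{F})$ is the minimum $n$ for which there is a common $n$-dimensional control function for all graphs in $\mathcal{F}$. A graph $H$ is a minor of $G$ if $H$ is isomorphic to a graph obtained from a subgraph of $G$ by contracting edges. -}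

module Defs where

open import Data.Nat using (ℕ; zero; suc; _≤_)
open import Data.Fin using (Fin)
open import Data.Fin.Subset using (Subset; _∈_)
open import Data.Bool using (Bool; T; false)
open import Data.Unit using (⊤)
open import Data.Empty using (⊥)
open import Data.Product using (Σ; ∃; ∃₂; _×_)
open import Relation.Nullary using (¬_)
open import Relation.Binary.PropositionalEquality using (_≡_; _≢_)

record Graph : Set where
  field
    size       : ℕ
    adj        : Fin size → Fin size → Bool
    adj-sym    : ∀ x y → adj x y ≡ adj y x
    adj-irrefl : ∀ x → adj x x ≡ false

open Graph public

V : Graph → Set
V G = Fin (size G)

Adj : (G : Graph) → V G → V G → Set
Adj G x y = T (adj G x y)

data WalkIn (G : Graph) (P : V G → Set) : ℕ → V G → V G → Set where
  stop : ∀ {x} → P x → WalkIn G P 0 x x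
  step : ∀ {k x y z} → P x → Adj G x y → WalkIn G P k y z → WalkIn G P (suc k) x z

Walk : (G : Graph) → ℕ → V G → V G → Set
Walk G = WalkIn G (λ _ → ⊤)

-- d_G(x,y) ≤ k  (d_G(x,y) = ∞ when there is no path; then this is false)
DistLe : (G : Graph) → ℕ → V G → V G → Set
DistLe G k x y = ∃ λ j → j ≤ k × Walk G j x y

DistGt : (G : Graph) → ℕ → V G → V G → Set
DistGt G r x y = ¬ DistLe G r x y

Collection : Graph → Set
Collection G = Σ ℕ λ m → Fin m → Subset (size G)

member : {G : Graph} → (𝒰 : Collection G) → Fin (Data.Product.proj₁ 𝒰) → Subset (size G)
member 𝒰 = Data.Product.proj₂ 𝒰

RDisjoint : (G : Graph) → ℕ → Collection G → Set
RDisjoint G r 𝒰 = ∀ i j → i ≢ j → ∀ x x' → x ∈ member {G} 𝒰 i → x' ∈ member {G} 𝒰 j → DistGt G r x x'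

Bounded : (G : Graph) → ℕ → Collection G → Set
Bounded G D 𝒰 = ∀ i x x' → x ∈ member {G} 𝒰 i → x' ∈ member {G} 𝒰 i → DistLe G D x x'

Covers : (G : Graph) (n : ℕ) → (Fin (suc n) → Collection G) → Set
Covers G n 𝒰s = ∀ x → ∃₂ λ c i → x ∈ member {G} (𝒰s c) i

-- f is an n-dimensional control function for the class 𝓕
-- (radius r and values of f restricted to ℕ)
IsControlFunction : ℕ → (Graph → Set) → (ℕ → ℕ) → Set
IsControlFunction n 𝓕 f =
  ∀ (G : Graph) → 𝓕 G → ∀ (r : ℕ) →
    Σ (Fin (suc n) → Collection G) λ 𝒰s →
      Covers G n 𝒰s × (∀ c → RDisjoint G r (𝒰s c) × Bounded G (f r) (𝒰s c))

HasControlFunction : ℕ → (Graph → Set) → Set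
HasControlFunction n 𝓕 = ∃ λ f → IsControlFunction n 𝓕 f

-- ad(𝓕) ≤ k : the minimum n admitting a control function is ≤ k
AsdimLe : (Graph → Set) → ℕ → Set
AsdimLe 𝓕 k = ∃ λ n → n ≤ k × HasControlFunction n 𝓕

record MinorModel (H G : Graph) : Set where
  field
    branch    : V H → Subset (size G)
    nonempty  : ∀ v → ∃ λ x → x ∈ branch v
    connected : ∀ v x y → x ∈ branch v → y ∈ branch v →
                ∃ λ k → WalkIn G (λ z → z ∈ branch v) k x y
    disjoint  : ∀ u v → u ≢ v → ∀ x → x ∈ branch u → x ∈ branch v → ⊥
    edges     : ∀ u v → Adj H u v →
                ∃₂ λ x y → x ∈ branch u × y ∈ branch v × Adj G x y

IsMinor : Graph → Graph → Set
IsMinor H G = MinorModel H G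

MinorFree : Graph → Graph → Set
MinorFree H G = ¬ IsMinor H G

{-# OPTIONS --safe #-}
module Submission where

-- Let Z₁, …, Zₘ be disjoint, connected, pairwise adjacent sets, and S a set
-- each of whose components touches all of them; as H is not a minor, m < |H|.
-- A component of S is swept by cells.  The first cell is a ball of bounded radius
-- around a union of m shortest paths, from one vertex to each Zᵢ.  A component
-- behind the cell that touches all Zᵢ has the cell as an additional set Zₘ₊₁, and
-- is decomposed by downward induction on m.  The components left over by this
-- which touch Z₁, …, Zₘ but not Zₘ₊₁ are far from the cell, and the next cells are
-- balls of bounded radius around their frontiers.  Such a frontier lies near
-- boundedly many lines, each a geodesic of some region around the component, so
-- the cell is coarsely one-dimensional: it has a 2-colouring θ whose monochromatic
-- pieces (bricks) are bounded, at any prescribed scale.  Combining θ with five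
-- concentric shells gives a 3-colouring of the cell that no monochromatic r-chain
-- crosses, while bricks longer than the chains found behind the cell absorb those.
-- Hence bounds deteriorate with the level m only, and not along the unbounded
-- sequence of cells.

open import Defs
open import Data.Nat
open import Data.Nat.Properties
open import Data.Nat.DivMod using (_/_; _%_; m<n*o⇒m/o<n; m≡m%n+[m/n]*n; m%n<n; m/n*n≤m)
open import Data.Nat.Tactic.RingSolver using (solve-∀)
open import Data.Bool using (Bool; true; false; not; T; T?)
open import Data.Bool.Properties using () renaming (_≟_ to _≟ᵇ_)
open import Data.Fin using (Fin; zero; suc; toℕ; finToFun; funToFin)
open import Data.Fin.Properties using (all?; any?; ¬∀⟶∃¬; toℕ-injective; finToFun-funToFin)
  renaming (_≟_ to _≟ᶠ_)
open import Data.Fin.Subset as Subset using (Subset; ∣_∣)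
open import Data.Fin.Subset.Properties using (x∈p⇒∣p-x∣<∣p∣; x∈p∧x≢y⇒x∈p-y; ∈⊤; ∣⊤∣≡n)
open import Data.List using (List; []; _∷_; _++_; length; tabulate)
open import Data.List.Properties using (length-++; length-tabulate)
open import Data.List.Relation.Unary.All as All using (All; []; _∷_)
import Data.List.Relation.Unary.All.Properties as All
open import Data.List.Relation.Unary.Any as Any using (Any; here; there)
import Data.List.Relation.Unary.Any.Properties as Any
open import Data.Vec as Vec using (lookup) renaming ([] to []ᵛ; _∷_ to _∷ᵛ_)
import Data.Vec.Properties as Vec
open import Data.Product using (Σ; ∃; ∃₂; _×_; _,_; proj₁; proj₂)
open import Data.Sum using (_⊎_; inj₁; inj₂)
open import Data.Empty using (⊥; ⊥-elim)
open import Data.Unit using (⊤; tt)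
open import Function using (_∘_; id; case_of_)
open import Level using (Level; Lift)
open import Relation.Nullary using (¬_; Dec; yes; no)
open import Relation.Nullary.Decidable
  using (does; dec-true; map′; decidable-stable; from-yes; _→-dec_; _×-dec_; _⊎-dec_; ¬?)
open import Relation.Binary.Definitions using (tri<; tri≈; tri>)
open import Relation.Binary.PropositionalEquality
open import Relation.Binary.Construct.Closure.ReflexiveTransitive as Star
  using (Star; ε; _◅_; _◅◅_; reverse)

-- The number of cells is unbounded, and a chain of one cell may run on into earlier cells and into
-- the decomposition behind it. Two invariants of `Partial` control this: by `wide`, uncoloured
-- vertices are farther than `r + r` from `M`; by `block`, a chain of good vertices starting that
-- close to `M` never has an uncoloured vertex within `r`. So only chains far from `M` can grow, and
-- each of these stays in one component of `S` minus `M`. Estimating them by the bound of the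
-- current level would be circular. Instead `local` supplies the smaller bound of the deeper level,
-- stated in the domain of a nearby geodesic, because that is where the zones of the next cell
-- measure excursions. The three groups of shells have different tasks. The innermost one catches
-- whatever comes from earlier cells and ends before the outer side of the cell, so that no growing
-- chain through the cell makes excursions both to earlier cells and behind it. The other two keep a
-- chain that starts near the cell from reaching uncoloured vertices.

private variable
  ℓ ℓ′ : Level
  𝒜 ℬ : Set ℓ

-- Every construction takes place under a double negation, where finite sets
-- satisfy excluded middle and choice; it is removed at the very end, since the
-- required cover is found by a finite search.
Classically : Set ℓ → Set ℓ
Classically 𝒜 = ¬ ¬ 𝒜

pure : 𝒜 → Classically 𝒜
pure x k = k x

infixl 1 _>>=_
_>>=_ : Classically 𝒜 → (𝒜 → Classically ℬ) → Classically ℬ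
(m >>= f) k = m (λ x → f x k)

decide : (𝒜 : Set ℓ) → Classically (Dec 𝒜)
decide 𝒜 k = k (no (λ x → k (yes x)))

choice : ∀ {n} {P : Fin n → Set ℓ} → (∀ i → Classically (P i)) → Classically (∀ i → P i)
choice {n = zero}  h k = k λ ()
choice {n = suc n} h = h zero >>= λ p → choice (h ∘ suc) >>= λ q → pure λ { zero → p ; (suc i) → q i }

choiceAll : ∀ {P : 𝒜 → Set ℓ′} (xs : List 𝒜) → (∀ x → Classically (P x)) → Classically (All P xs)
choiceAll []       h = pure []
choiceAll (x ∷ xs) h = h x >>= λ p → choiceAll xs h >>= λ ps → pure (p ∷ ps)

decide₁ : ∀ {n} (P : Fin n → Set ℓ) → Classically (∀ i → Dec (P i))
decide₁ P = choice λ i → decide (P i)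

least : (P : ℕ → Set) → ∀ k → P k → Classically (∃ λ j → j ≤ k × P j × (∀ i → P i → j ≤ i))
least P zero    p = pure (0 , z≤n , p , λ _ _ → z≤n)
least P (suc k) p = decide (P 0) >>= λ where
  (yes p₀) → pure (0 , z≤n , p₀ , λ _ _ → z≤n)
  (no ¬p₀) → least (P ∘ suc) k p >>= λ (j , j≤k , pj , min) →
    pure (suc j , s≤s j≤k , pj , λ { zero q → ⊥-elim (¬p₀ q) ; (suc i) q → s≤s (min i q) })

-- A linear inequality follows from the sum X ≤ Y of some hypotheses, with
-- slack s, as soon as the displayed semiring identity holds.
linear : ∀ {X Y x y} s → X ≤ Y → (x + Y) + s ≡ y + X → x ≤ y
linear {X} {Y} {x} {y} s X≤Y e =
  +-cancelʳ-≤ Y x y (≤-trans (≤-trans (m≤m+n (x + Y) s) (≤-reflexive e)) (+-monoʳ-≤ y X≤Y))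

infixl 6 _⊕_
_⊕_ : ∀ {a b c d} → a ≤ b → c ≤ d → a + c ≤ b + d
_⊕_ = +-mono-≤

-- Cutting a chain at its visits to a set.

module Chains {ℓ} {V : Set} (L : V → V → Set ℓ) (L-sym : ∀ {u v} → L u v → L v u)
              (A : V → Set) (A? : ∀ v → Dec (A v)) where

  Off : V → V → Set ℓ
  Off u v = L u v × ¬ A u × ¬ A v

  Off-sym : ∀ {u v} → Off u v → Off v u
  Off-sym (l , p , q) = L-sym l , q , p

  Enter : V → V → Set ℓ
  Enter x a = x ≡ a ⊎ (∃ λ u → ¬ A x × Star Off x u × ¬ A u × L u a)

  Hop : V → V → Set ℓ
  Hop a b = A a × A b × (L a b ⊎ (∃₂ λ u v → L a u × ¬ A u × Star Off u v × ¬ A v × L v b))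

  -- The chain is cut at its first and last visits to `A`. The tail is stored reversed, as an entry
  -- from `y`, so that one estimate serves both ends. The excursions inside the hops avoid `A` and
  -- fall under bounds known before `A` was coloured.
  decompose : ∀ {x y} → Star L x y →
    (¬ A x × ¬ A y × Star Off x y) ⊎ (∃₂ λ a b → A a × A b × Enter x a × Star Hop a b × Enter y b)
  decompose {x} ε with A? x
  ... | yes p = inj₂ (x , x , p , p , inj₁ refl , ε , inj₁ refl)
  ... | no ¬p = inj₁ (¬p , ¬p , ε)
  decompose {x} (l ◅ s) with A? x | decompose s
  ... | no ¬x | inj₁ (¬x' , ¬y , s') = inj₁ (¬x , ¬y , (l , ¬x , ¬x') ◅ s')
  ... | no ¬x | inj₂ (a , b , pa , pb , inj₁ refl , h , f) =
    inj₂ (a , b , pa , pb , inj₂ (x , ¬x , ε , ¬x , l) , h , f)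
  ... | no ¬x | inj₂ (a , b , pa , pb , inj₂ (u , ¬x' , s' , ¬u , l') , h , f) =
    inj₂ (a , b , pa , pb , inj₂ (u , ¬x , (l , ¬x , ¬x') ◅ s' , ¬u , l') , h , f)
  ... | yes p | inj₁ (¬x' , ¬y , s') =
    inj₂ (x , x , p , p , inj₁ refl , ε , inj₂ (_ , ¬y , reverse Off-sym s' , ¬x' , L-sym l))
  ... | yes p | inj₂ (a , b , pa , pb , inj₁ refl , h , f) =
    inj₂ (x , b , p , pb , inj₁ refl , (p , pa , inj₁ l) ◅ h , f)
  ... | yes p | inj₂ (a , b , pa , pb , inj₂ (u , ¬x' , s' , ¬u , l') , h , f) =
    inj₂ (x , b , p , pb , inj₁ refl , (p , pa , inj₂ (_ , u , l , ¬x' , s' , ¬u , l')) ◅ h , f)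

  enter-unique : ∀ {x a} → A x → Enter x a → x ≡ a
  enter-unique p (inj₁ e) = e
  enter-unique p (inj₂ (_ , ¬p , _)) = ⊥-elim (¬p p)

  hops : ∀ {a b} → A a → A b → Star L a b → Star Hop a b
  hops {a} {b} p q s with decompose s
  ... | inj₁ (¬p , _) = ⊥-elim (¬p p)
  ... | inj₂ (a' , b' , _ , _ , e , h , f) with enter-unique p e | enter-unique q f
  ...   | refl | refl = h

-- Walks, metrics of vertex sets, geodesics.

module Walks (G : Graph) where

  Sub : Set₁
  Sub = V G → Set

  infix 4 _⊆_
  _⊆_ : Sub → Sub → Set
  P ⊆ Q = ∀ {v} → P v → Q v

  adj-flip : ∀ {x y} → Adj G x y → Adj G y x
  adj-flip {x} {y} = subst T (adj-sym G x y)

  mapWalk : ∀ {P Q : Sub} {k x y} → P ⊆ Q → WalkIn G P k x y → WalkIn G Q k x y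
  mapWalk f (stop p)     = stop (f p)
  mapWalk f (step p a w) = step (f p) a (mapWalk f w)

  source : ∀ {P : Sub} {k x y} → WalkIn G P k x y → P x
  source (stop p)     = p
  source (step p _ _) = p

  target : ∀ {P : Sub} {k x y} → WalkIn G P k x y → P y
  target (stop p)     = p
  target (step _ _ w) = target w

  concat : ∀ {P : Sub} {k l x y z} → WalkIn G P k x y → WalkIn G P l y z → WalkIn G P (k + l) x z
  concat (stop _)     w' = w'
  concat (step p a w) w' = step p a (concat w w')

  snoc : ∀ {P : Sub} {k x y z} → WalkIn G P k x y → Adj G y z → P z → WalkIn G P (suc k) x z
  snoc (stop p)     a q = step p a (stop q)
  snoc (step p b w) a q = step p b (snoc w a q)

  rev : ∀ {P : Sub} {k x y} → WalkIn G P k x y → WalkIn G P k y x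
  rev (stop p)     = stop p
  rev (step p a w) = snoc (rev w) (adj-flip a) p

  Dist : Sub → ℕ → V G → V G → Set
  Dist P k x y = ∃ λ j → j ≤ k × WalkIn G P j x y

  Reach : Sub → V G → V G → Set
  Reach P x y = ∃ λ j → WalkIn G P j x y

  dist-refl : ∀ {P : Sub} {k x} → P x → Dist P k x x
  dist-refl p = 0 , z≤n , stop p

  dist-sym : ∀ {P k x y} → Dist P k x y → Dist P k y x
  dist-sym (j , le , w) = j , le , rev w

  dist-trans : ∀ {P k l x y z} → Dist P k x y → Dist P l y z → Dist P (k + l) x z
  dist-trans (i , p , w) (j , q , w') = i + j , p ⊕ q , concat w w'

  dist-mono : ∀ {P Q : Sub} {k l x y} → P ⊆ Q → k ≤ l → Dist P k x y → Dist Q l x y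
  dist-mono f le (j , p , w) = j , ≤-trans p le , mapWalk f w

  dist-≤ : ∀ {P : Sub} {k l x y} → k ≤ l → Dist P k x y → Dist P l x y
  dist-≤ {P} = dist-mono {P} {P} id

  dist-⊆ : ∀ {P Q : Sub} {k x y} → P ⊆ Q → Dist P k x y → Dist Q k x y
  dist-⊆ f = dist-mono f ≤-refl

  reach-refl : ∀ {P : Sub} {x} → P x → Reach P x x
  reach-refl p = 0 , stop p

  reach-sym : ∀ {P x y} → Reach P x y → Reach P y x
  reach-sym (j , w) = j , rev w

  reach-trans : ∀ {P x y z} → Reach P x y → Reach P y z → Reach P x z
  reach-trans (i , w) (j , w') = i + j , concat w w'

  reach-⊆ : ∀ {P Q : Sub} {x y} → P ⊆ Q → Reach P x y → Reach Q x y
  reach-⊆ f (j , w) = j , mapWalk f w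

  edge : ∀ {P : Sub} {x y} → P x → Adj G x y → P y → Reach P x y
  edge p a q = 1 , step p a (stop q)

  firstExit : ∀ {P Q : Sub} {k x y} → (∀ v → Dec (Q v)) → WalkIn G P k x y → Q x →
    WalkIn G Q k x y ⊎ (∃₂ λ i j → ∃₂ λ u z → suc i + j ≡ k × WalkIn G Q i x u × Adj G u z × ¬ Q z × WalkIn G P j z y)
  firstExit Q? (stop p) q = inj₁ (stop q)
  firstExit Q? (step {y = x'} p a w) q with Q? x'
  ... | no ¬q = inj₂ (0 , _ , _ , x' , refl , stop q , a , ¬q , w)
  ... | yes q' with firstExit Q? w q'
  ...   | inj₁ w' = inj₁ (step q a w')
  ...   | inj₂ (i , j , u , z , e , w' , b , ¬z , w'') =
    inj₂ (suc i , j , u , z , cong suc e , step q a w' , b , ¬z , w'')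

  -- Turns distance into confinement: together with `staysIn`, a short walk from a vertex far from
  -- `M` cannot leave its component of the complement of `M`.
  avoiding : ∀ {P M : Sub} {k x y} → (∀ {z} → M z → Dist P k x z → ⊥) → WalkIn G P k x y →
    WalkIn G (λ v → P v × ¬ M v) k x y
  avoiding h (stop p)     = stop (p , λ q → h q (0 , z≤n , stop p))
  avoiding {P} h (step p a w) = step (p , λ q → h q (0 , z≤n , stop p)) a
    (avoiding (λ { q (j , le , w') → h q (suc j , s≤s le , step p a w') }) w)

  staysIn : ∀ {P Q : Sub} {k x y} → (∀ {u v} → Q u → P v → Adj G u v → Q v) →
    WalkIn G P k x y → Q x → WalkIn G Q k x y
  staysIn c (stop p)     q = stop q
  staysIn c (step p a w) q = step q a (staysIn c w (c q (source w) a))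

  -- line is a geodesic for the metric of dom, which need not be one for that of G.
  record Geodesic : Set₁ where
    field
      dom   : Sub
      depth : V G → ℕ
      line  : Sub
      lip   : ∀ {u v} → dom u → dom v → Adj G u v → depth v ≤ suc (depth u)
      geo   : ∀ {s t} k → line s → line t → depth s ≤ k + depth t → depth t ≤ k + depth s → Dist dom k s t

  open Geodesic public

  lipWalk : ∀ (e : Geodesic) {k u v} → WalkIn G (dom e) k u v → depth e v ≤ k + depth e u
  lipWalk e (stop _)             = ≤-refl
  lipWalk e {suc k} {u} {v} (step {y = x} p a w) = ≤-trans (lipWalk e w)
    (≤-trans (+-monoʳ-≤ k (lip e p (source w) a)) (≤-reflexive (+-suc k _)))

  lipDist : ∀ (e : Geodesic) {k u v} → Dist (dom e) k u v → depth e v ≤ k + depth e u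
  lipDist e (j , le , w) = ≤-trans (lipWalk e w) (+-monoˡ-≤ _ le)

  Near : ℕ → Geodesic → V G → Set
  Near Λ e v = ∃ λ t → line e t × Dist (dom e) Λ v t

  near-dom : ∀ {Λ e v} → Near Λ e v → dom e v
  near-dom (_ , _ , (_ , _ , w)) = source w

  near-shift : ∀ {Λ k e u v} → Dist (dom e) k u v → Near Λ e v → Near (k + Λ) e u
  near-shift {e = e} d (t , l , d') = t , l , dist-trans {dom e} d d'

  near-≤ : ∀ {Λ Λ' e v} → Λ ≤ Λ' → Near Λ e v → Near Λ' e v
  near-≤ {e = e} le (t , l , d) = t , l , dist-≤ {dom e} le d

  Nested : List Geodesic → Set₁
  Nested []       = Lift _ ⊤
  Nested (e ∷ es) = All (λ e' → dom e' ⊆ dom e) es × Nested es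

-- Two-colourings of neighbourhoods of finitely many geodesics.

odd : ℕ → Bool
odd zero    = false
odd (suc n) = not (odd n)

not-fixed : ∀ b → b ≢ not b
not-fixed true  ()
not-fixed false ()

odd-close : ∀ {x y} → x ≤ suc y → y ≤ suc x → odd x ≡ odd y → x ≡ y
odd-close {x} {y} p q e with <-cmp x y
... | tri≈ _ x≡y _ = x≡y
... | tri< x<y _ _ rewrite ≤-antisym q x<y = ⊥-elim (not-fixed _ e)
... | tri> _ _ y<x rewrite ≤-antisym p y<x = ⊥-elim (not-fixed _ (sym e))

band : ℕ → ℕ → ℕ
band N x = x / suc N

band-step : ∀ N {x y} → x ≤ N + y → band N x ≤ suc (band N y)
band-step N {x} {y} le = s≤s⁻¹ (m<n*o⇒m/o<n (begin-strict
  x                                  ≤⟨ le ⟩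
  N + y                              <⟨ n<1+n _ ⟩
  suc N + y                          ≡⟨ cong (suc N +_) (m≡m%n+[m/n]*n y (suc N)) ⟩
  suc N + (y % suc N + q * suc N)    ≤⟨ +-monoʳ-≤ (suc N) (+-monoˡ-≤ (q * suc N) (<⇒≤ (m%n<n y (suc N)))) ⟩
  suc N + (suc N + q * suc N)        ∎))
  where
    open ≤-Reasoning
    q = y / suc N

band-≤ : ∀ N {x y} → band N x ≡ band N y → x ≤ N + y
band-≤ N {x} {y} e = begin
  x                            ≡⟨ m≡m%n+[m/n]*n x (suc N) ⟩
  x % suc N + band N x * suc N ≤⟨ +-mono-≤ (s≤s⁻¹ (m%n<n x (suc N))) (≤-reflexive (cong (_* suc N) e)) ⟩
  N + band N y * suc N         ≤⟨ +-monoʳ-≤ N (m/n*n≤m y (suc N)) ⟩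
  N + y                        ∎
  where open ≤-Reasoning

anyAll : ∀ {P : 𝒜 → Set ℓ} {Q : 𝒜 → Set ℓ′} {xs} → All P xs → Any Q xs → ∃ λ x → P x × Q x
anyAll (p ∷ ps) (here q)  = _ , p , q
anyAll (p ∷ ps) (there q) = anyAll ps q

-- The summands follow a chain: `q + R` to the first vertex near the geodesic, `Λ` to its foot on
-- the line, `Λ + (N + Λ)` along the line, `Λ` off it again, and `q + R` to the end.
zoneBound : ℕ → ℕ → ℕ → ℕ
zoneBound Λ R zero    = 0
zoneBound Λ R (suc K) = let q = zoneBound Λ R K ; N = R + (q + R) in
  (q + R) + ((Λ + ((Λ + (N + Λ)) + Λ)) + (q + R))

module Zones (G : Graph) where
  open Walks G

  Covered : ℕ → List Geodesic → V G → Set₁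
  Covered Λ es v = Any (λ e → Near Λ e v) es

  -- A jump is measured in the domain of the first geodesic near one of its ends;
  -- the domains decrease along the list, so this is the coarsest metric available.
  Jump : ℕ → ℕ → List Geodesic → V G → V G → Set
  Jump Λ R []       v w = ⊥
  Jump Λ R (e ∷ es) v w = ((Near Λ e v ⊎ Near Λ e w) × Dist (dom e) R v w)
                        ⊎ (¬ Near Λ e v × ¬ Near Λ e w × Jump Λ R es v w)

  jump-sym : ∀ {Λ R} es {v w} → Jump Λ R es v w → Jump Λ R es w v
  jump-sym (e ∷ es) (inj₁ (inj₁ n , d)) = inj₁ (inj₂ n , dist-sym {dom e} d)
  jump-sym (e ∷ es) (inj₁ (inj₂ n , d)) = inj₁ (inj₁ n , dist-sym {dom e} d)
  jump-sym (e ∷ es) (inj₂ (¬v , ¬w , j)) = inj₂ (¬w , ¬v , jump-sym es j)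

  Near? : ℕ → List Geodesic → Set₁
  Near? Λ es = All (λ e → ∀ v → Dec (Near Λ e v)) es

  jump-inside : ∀ {Λ R es v w} {X : Sub} → Near? Λ es → All (λ e → X ⊆ dom e) es →
    Dist X R v w → Covered Λ es v → Jump Λ R es v w
  jump-inside {es = e ∷ es} {v} {w} (n? ∷ ns) (i ∷ is) d c with n? v | n? w
  ... | yes n | _     = inj₁ (inj₁ n , dist-⊆ i d)
  ... | no _  | yes n = inj₁ (inj₂ n , dist-⊆ i d)
  ... | no ¬n | no ¬m with c
  ...   | here n  = ⊥-elim (¬n n)
  ...   | there c' = inj₂ (¬n , ¬m , jump-inside ns is d c')

  jump-along : ∀ {Λ R es v w} → Near? Λ es → Nested es →
    Any (λ e → Near Λ e v × Dist (dom e) R v w) es → Jump Λ R es v w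
  jump-along {es = e ∷ es} _ _ (here (n , d)) = inj₁ (inj₁ n , d)
  jump-along {es = e ∷ es} {v} {w} (n? ∷ ns) (i , is) (there c) with n? v | n? w
  ... | no ¬n | no ¬m = inj₂ (¬n , ¬m , jump-along ns is c)
  ... | yes n | _ with anyAll i c
  ...   | e' , i' , (_ , d) = inj₁ (inj₁ n , dist-⊆ i' d)
  jump-along {es = e ∷ es} {v} {w} (n? ∷ ns) (i , is) (there c) | no _ | yes n with anyAll i c
  ...   | e' , i' , (_ , d) = inj₁ (inj₂ n , dist-⊆ i' d)

  ZLink : ℕ → ℕ → List Geodesic → (V G → Bool) → V G → V G → Set₁
  ZLink Λ R es θ v w = Covered Λ es v × Covered Λ es w × Jump Λ R es v w × θ v ≡ θ w

  -- The bound holds in the domain of one geodesic that the vertex is near, since `local` of the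
  -- exits behind the cell has to be supplied in this form.
  Zoned : ℕ → ℕ → ℕ → List Geodesic → (V G → Bool) → Set₁
  Zoned Λ R q es θ = ∀ v → Covered Λ es v →
    Any (λ e → (∀ w → Star (ZLink Λ R es θ) v w → Dist (dom e) q v w) × Near (q + Λ) e v) es

  -- Near the first geodesic, θ is the parity of the band of depths; the bands are
  -- wider than R + (q + R), the longest excursion through the later zones.
  zone : ∀ Λ R K es → length es ≤ K → Nested es →
    Classically (Σ (V G → Bool) (Zoned Λ R (zoneBound Λ R K) es))
  zone Λ R K       []       _        _              = pure ((λ _ → false) , λ _ ())
  zone Λ R (suc K) (e ∷ es) (s≤s le) (inner , nest) =
    zone Λ R K es le nest >>= λ (θ' , zoned) →
    decide₁ (Near Λ e) >>= λ near? →
    extend θ' zoned near?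
    where
    q = zoneBound Λ R K
    N = R + (q + R)
    M = Λ + ((Λ + (N + Λ)) + Λ)

    extend : ∀ θ' → Zoned Λ R q es θ' → (∀ v → Dec (Near Λ e v)) →
      Classically (Σ (V G → Bool) (Zoned Λ R ((q + R) + (M + (q + R))) (e ∷ es)))
    extend θ' zoned near? =
      decide₁ (λ v → ∃ λ u → Star L v u × Near Λ e u) >>= λ touches? → pure (θ , result touches?)
      where
      θ : V G → Bool
      θ v with near? v
      ... | yes _ = odd (band N (depth e v))
      ... | no _  = θ' v

      θ-on : ∀ {v} → Near Λ e v → θ v ≡ odd (band N (depth e v))
      θ-on {v} n with near? v
      ... | yes _ = refl
      ... | no ¬n = ⊥-elim (¬n n)

      θ-off : ∀ {v} → ¬ Near Λ e v → θ v ≡ θ' v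
      θ-off {v} ¬n with near? v
      ... | yes n = ⊥-elim (¬n n)
      ... | no _  = refl

      L : V G → V G → Set₁
      L = ZLink Λ R (e ∷ es) θ

      L-sym : ∀ {u v} → L u v → L v u
      L-sym (c , c' , j , eq) = c' , c , jump-sym (e ∷ es) j , sym eq

      open Chains L L-sym (Near Λ e) near?

      cover : ∀ {v} → ¬ Near Λ e v → Covered Λ (e ∷ es) v → Covered Λ es v
      cover ¬n (here n)  = ⊥-elim (¬n n)
      cover ¬n (there c) = c

      restLink : ∀ {u v} → Off u v → ZLink Λ R es θ' u v
      restLink ((c , c' , inj₁ (inj₁ n , _) , eq) , ¬u , ¬v) = ⊥-elim (¬u n)
      restLink ((c , c' , inj₁ (inj₂ n , _) , eq) , ¬u , ¬v) = ⊥-elim (¬v n)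
      restLink ((c , c' , inj₂ (_ , _ , j) , eq) , ¬u , ¬v) =
        cover ¬u c , cover ¬v c' , j , trans (sym (θ-off ¬u)) (trans eq (θ-off ¬v))

      rest : ∀ {u v} → ¬ Near Λ e u → Covered Λ (e ∷ es) u → Star Off u v → Dist (dom e) q u v
      rest ¬u c s with anyAll inner (zoned _ (cover ¬u c))
      ... | e' , i , (far , _) = dist-⊆ i (far _ (Star.map restLink s))

      nearStep : ∀ {u v} → Near Λ e u ⊎ Near Λ e v → L u v → Dist (dom e) R u v
      nearStep _ (_ , _ , inj₁ (_ , d) , _) = d
      nearStep (inj₁ n) (_ , _ , inj₂ (¬n , _ , _) , _) = ⊥-elim (¬n n)
      nearStep (inj₂ n) (_ , _ , inj₂ (_ , ¬n , _) , _) = ⊥-elim (¬n n)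

      hopDist : ∀ {a b} → Hop a b → Dist (dom e) N a b
      hopDist (p , p' , inj₁ l) = dist-≤ {dom e} (m≤m+n R _) (nearStep (inj₁ p) l)
      hopDist (p , p' , inj₂ (u , v , l , ¬u , s , ¬v , l')) =
        dist-trans {dom e} (nearStep (inj₁ p) l)
          (dist-trans {dom e} (rest ¬u (proj₁ (proj₂ l)) s) (nearStep (inj₂ p') l'))

      hopθ : ∀ {a b} → Hop a b → θ a ≡ θ b
      hopθ (p , p' , inj₁ (_ , _ , _ , eq)) = eq
      hopθ (p , p' , inj₂ (u , v , (_ , _ , _ , eq) , ¬u , s , ¬v , (_ , _ , _ , eq'))) =
        trans eq (trans (Star.fold (λ x y → θ x ≡ θ y) (λ ((_ , _ , _ , h) , _) → trans h) refl s) eq')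

      -- A hop changes the depth by at most `N`, hence leads to the same or a neighbouring band, and
      -- equal colours exclude the neighbour.
      hopBand : ∀ {a b} → Hop a b → band N (depth e a) ≡ band N (depth e b)
      hopBand h@(p , p' , _) = odd-close
        (band-step N (lipDist e (dist-sym {dom e} (hopDist h)))) (band-step N (lipDist e (hopDist h)))
        (trans (sym (θ-on p)) (trans (hopθ h) (θ-on p')))

      hopsBand : ∀ {a b} → Star Hop a b → band N (depth e a) ≡ band N (depth e b)
      hopsBand = Star.fold (λ x y → band N (depth e x) ≡ band N (depth e y)) (λ h → trans (hopBand h)) refl

      around : ∀ {x y s t} → x ≤ Λ + s → s ≤ N + t → t ≤ Λ + y → x ≤ (Λ + (N + Λ)) + y
      around {x} {y} {s} {t} h₁ h₂ h₃ = linear 0 (h₁ ⊕ h₂ ⊕ h₃) (identity x y s t Λ N)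
        where
        identity : ∀ x y s t Λ N →
          (x + (Λ + s + (N + t) + (Λ + y))) + 0 ≡ ((Λ + (N + Λ)) + y) + (x + s + t)
        identity = solve-∀

      hopsDist : ∀ {a b} → Near Λ e a → Near Λ e b → Star Hop a b → Dist (dom e) M a b
      hopsDist (s , ls , ds) (t , lt , dt) h =
        dist-trans {dom e} ds (dist-trans {dom e}
          -- Closeness in depth implies closeness in `dom e` only on the line, so the estimate
          -- passes through the feet `s` and `t`; these inherit it from `a` and `b`, which share a
          -- band.
          (geo e (Λ + (N + Λ)) ls lt
            (around (lipDist e ds) (band-≤ N eq) (lipDist e (dist-sym {dom e} dt)))
            (around (lipDist e dt) (band-≤ N (sym eq)) (lipDist e (dist-sym {dom e} ds))))
          (dist-sym {dom e} dt))
        where eq = hopsBand h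

      enterDist : ∀ {x a} → Covered Λ (e ∷ es) x → Near Λ e a → Enter x a → Dist (dom e) (q + R) x a
      enterDist c p (inj₁ refl) = dist-refl (near-dom {e = e} p)
      enterDist c p (inj₂ (u , ¬x , s , ¬u , l)) =
        dist-trans {dom e} (rest ¬x c s) (nearStep (inj₂ p) l)

      end : ∀ {x y} → Covered Λ (e ∷ es) x → Star L x y → Covered Λ (e ∷ es) y
      end c ε = c
      end c (l ◅ s) = end (proj₁ (proj₂ l)) s

      bounded : ∀ {v w} → Covered Λ (e ∷ es) v → Star L v w → Dist (dom e) ((q + R) + (M + (q + R))) v w
      bounded c s with decompose s
      ... | inj₁ (¬v , _ , o) = dist-≤ {dom e} (≤-trans (m≤m+n q R) (m≤m+n (q + R) _)) (rest ¬v c o)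
      ... | inj₂ (a , b , pa , pb , f , h , g) = dist-trans {dom e} (enterDist c pa f)
        (dist-trans {dom e} (hopsDist pa pb h) (dist-sym {dom e} (enterDist (end c s) pb g)))

      result : (∀ v → Dec (∃ λ u → Star L v u × Near Λ e u)) → Zoned Λ R _ (e ∷ es) θ
      result touches? v c with touches? v
      ... | yes (u , s , n) = here ((λ w → bounded c) , near-shift {e = e} (bounded c s) n)
      -- A chain that never comes near `e` is coloured by `θ'` throughout, so the geodesic found for
      -- it in the tail still serves.
      ... | no ¬t = there (Any.map (λ {e'} → widen {e'}) (zoned v (cover (λ n → ¬t (v , ε , n)) c)))
        where
        off : ∀ {w} → Star L v w → Star (ZLink Λ R es θ') v w
        off s with decompose s
        ... | inj₁ (_ , _ , o) = Star.map restLink o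
        ... | inj₂ (a , b , pa , pb , inj₁ refl , _ , _) = ⊥-elim (¬t (a , ε , pa))
        ... | inj₂ (a , b , pa , pb , inj₂ (u , _ , o , _ , l) , _ , _) =
          ⊥-elim (¬t (a , Star.map proj₁ o ◅◅ (l ◅ ε) , pa))
        q≤ : q ≤ (q + R) + (M + (q + R))
        q≤ = ≤-trans (m≤m+n q R) (m≤m+n (q + R) _)
        widen : ∀ {e'} → (∀ w → Star (ZLink Λ R es θ') v w → Dist (dom e') q v w) × Near (q + Λ) e' v →
          (∀ w → Star L v w → Dist (dom e') ((q + R) + (M + (q + R))) v w) × Near ((q + R) + (M + (q + R)) + Λ) e' v
        widen {e'} (f , n) = (λ w s → dist-≤ {dom e'} q≤ (f w (off s))) , near-≤ {e = e'} (+-monoˡ-≤ Λ q≤) n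

-- `len` counts the geodesics of an exit, `thick` is the distance from its frontier `B` to them,
-- `rim` the depth to which colours extend beyond `B`, `diam` the bound on chains, and `off` the
-- distance from a growing chain to the geodesic whose domain measures it.
record Bounds : Set where
  field len thick rim diam off : ℕ

open Bounds public

-- The inductive statement and the geometry of one cell.

module Levels (G : Graph) (r : ℕ) where
  open Walks G

  Touch : Sub → V G → Set
  Touch Z u = ∃ λ z → Z z × Adj G u z

  record Clique {m} (Z : Fin m → Sub) : Set where
    field
      inhabited : ∀ i → ∃ λ x → Z i x
      joined    : ∀ i {x y} → Z i x → Z i y → Reach (Z i) x y
      disjoint  : ∀ {i j x} → i ≢ j → Z i x → Z j x → ⊥
      adjacent  : ∀ {i j} → i ≢ j → ∃ λ x → Z i x × Touch (Z j) x

  module Stage {m} (Z : Fin m → Sub) (S : Sub) where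

    -- Vertices near some Zᵢ are left to the enclosing level, which recolours them.
    Good : V G → Set
    Good v = ∀ i → ¬ (∃ λ u → Dist S r v u × Touch (Z i) u)

    Link : Sub → (V G → Fin 3) → V G → V G → Set
    Link W χ u v = (W u × Good u) × (W v × Good v) × χ u ≡ χ v × Dist S r u v

    Chain : Sub → (V G → Fin 3) → V G → V G → Set
    Chain W χ = Star (Link W χ)

    link-sym : ∀ {W χ u v} → Link W χ u v → Link W χ v u
    link-sym (p , q , e , d) = q , p , sym e , dist-sym {S} d

    Outside : Sub → Sub
    Outside M v = S v × ¬ M v

    Escapes : Sub → V G → Set
    Escapes M v = ∃ λ i → ∀ u → Reach (Outside M) v u → ¬ Touch (Z i) u

    -- M is the part of S already decomposed, W ⊇ M the part coloured so far, and
    -- E the component of S ∖ M through v; together with the connected set O ⊇ B,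
    -- it is separated from the rest of S by B.  By local, a chain that could
    -- still grow is bounded even in the domain of a geodesic near it.
    record Exit (c : Bounds) (M W : Sub) (χ : V G → Fin 3) (v : V G) : Set₁ where
      field
        E B O     : Sub
        start     : E v
        E⊆        : E ⊆ Outside M
        E-joined  : ∀ {u} → E u → Reach E v u
        E-closed  : ∀ {u w} → E u → Outside M w → Adj G u w → E w
        B⊆E       : B ⊆ E
        B-inhab   : ∃ λ b → B b
        B⊆O       : B ⊆ O
        O∩E⊆B     : ∀ {u} → O u → E u → B u
        O⊆S       : O ⊆ S
        O-joined  : ∀ {u w} → O u → O w → Reach O u w
        O-touches : ∀ i → ∃ λ o → O o × Touch (Z i) o
        frontier  : ∀ {u w} → E u → S w → ¬ E w → Adj G u w → B u
        es        : List Geodesic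
        es-length : length es ≤ len c
        es-nested : Nested es
        es-around : All (λ e → E ⊆ dom e) es
        es-inside : All (λ e → dom e ⊆ S) es
        B-near    : ∀ {b} → B b → Any (λ e → Near (thick c) e b) es
        rim-near  : ∀ {u} → W u → E u → ∃ λ b → B b × Dist E (rim c) u b
        local     : ∀ {u w y} → E u → W u → Good u → Chain W χ u w → S y → ¬ W y → Dist S r w y →
                    Any (λ e → (∀ t → Chain W χ u t → Dist (dom e) (diam c) u t) × Near (off c) e u) es

    -- The radius `r + r` is that of a link followed by the distance `r` at which `cell-near` finds
    -- the deeper `M′`; `cross` spends both.
    record Partial (D : ℕ) (M W : Sub) (χ : V G → Fin 3) : Set where
      field
        M⊆W     : M ⊆ W
        W⊆S     : W ⊆ S
        wide    : ∀ {v z} → S v → M z → Dist S (r + r) v z → W v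
        bounded : ∀ {v w} → W v → Good v → Chain W χ v w → Dist S D v w
        block   : ∀ {v z w y} → W v → Good v → M z → Dist S (r + r) v z → Chain W χ v w →
                  S y → ¬ W y → Dist S r w y → ⊥

    record Output (c : Bounds) : Set₁ where
      field
        M W     : Sub
        χ       : V G → Fin 3
        partial : Partial (diam c) M W χ
        exits   : ∀ v → Outside M v → Exit c M W χ v × Escapes M v

  Decomposable : ℕ → Bounds → Set₁
  Decomposable m c = (Z : Fin m → Sub) (S : Sub) → Clique Z → (∀ i {v} → S v → Z i v → ⊥) →
    (∀ {v} → S v → ∀ i → ∃ λ u → Reach S v u × Touch (Z i) u) →
    Classically (Stage.Output Z S c)

  -- The cell Y is the ball around B in the component E, and S′ is the part of
  -- E ∖ Y that still touches every Zᵢ; Z′ is the clique for the next level.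
  module Cell {m} (Z : Fin m → Sub) (S : Sub) (clique : Clique Z)
      (apart : ∀ i {v} → S v → Z i v → ⊥)
      (σ : ℕ) {c M W χ v₀} (exit : Stage.Exit Z S c M W χ v₀)
      (E? : ∀ v → Dec (Stage.Exit.E exit v))
      (f : V G → ℕ)
      (f-attained : ∀ {v} → Stage.Exit.E exit v → ∃ λ b → Stage.Exit.B exit b × Dist (Stage.Exit.E exit) (f v) v b)
      (f-minimal : ∀ {v b k} → Stage.Exit.B exit b → Dist (Stage.Exit.E exit) k v b → f v ≤ k) where
    open Stage Z S
    open Exit exit

    f-base : ∀ {b} → B b → f b ≡ 0
    f-base p = n≤0⇒n≡0 (f-minimal p (dist-refl {E} (B⊆E p)))

    f-dist : ∀ {k u v} → Dist E k u v → f u ≤ k + f v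
    f-dist {v = v} d@(_ , _ , w) with f-attained (target w)
    ... | b , p , d' = f-minimal p (dist-trans {E} d d')

    f-walk : ∀ {k u v} → WalkIn G E k u v → f u ≤ k + f v
    f-walk w = f-dist (_ , ≤-refl , w)

    Y A : Sub
    Y v = E v × f v ≤ σ
    A v = E v × σ < f v

    A? : ∀ v → Dec (A v)
    A? v with E? v | suc σ ≤? f v
    ... | no ¬e | _     = no (λ p → ¬e (proj₁ p))
    ... | yes e | yes p = yes (e , p)
    ... | yes e | no ¬p = no (λ q → ¬p (proj₂ q))

    -- `f` drops by at most one per step, so `k` steps from above `σ + k` never enter the cell.
    deep : ∀ {k u v} → WalkIn G E k u v → σ + k < f u → WalkIn G A k u v
    deep (stop p) lt = stop (p , ≤-trans (s≤s (m≤m+n σ 0)) lt)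
    deep {suc k} {u} (step {y = x} p a w) lt =
      step (p , ≤-trans (s≤s (m≤m+n σ (suc k))) lt) a (deep w (s≤s⁻¹ (begin-strict
        suc (σ + k)   ≡⟨ +-suc σ k ⟨
        σ + suc k     <⟨ lt ⟩
        f u           ≤⟨ f-walk (step p a (stop (source w))) ⟩
        suc (f x)     ∎)))
      where open ≤-Reasoning hiding (stop)

    S′ : Sub
    S′ v = A v × (∀ i → ∃ λ u → Reach A v u × Touch (Z i) u)

    S′⊆A : S′ ⊆ A
    S′⊆A = proj₁

    S′⊆E : S′ ⊆ E
    S′⊆E = proj₁ ∘ proj₁

    S′-reach : ∀ {u v} → S′ u → Reach A u v → S′ v
    S′-reach (p , h) (k , w) = target w , λ i → case h i of λ (x , s , t) →
      x , reach-trans {A} (reach-sym {A} (k , w)) s , t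

    S′-closed : ∀ {u v} → S′ u → A v → Adj G u v → S′ v
    S′-closed p q a = S′-reach p (edge {A} (S′⊆A p) a q)

    S′-walk : ∀ {k u v} → WalkIn G A k u v → S′ u → WalkIn G S′ k u v
    S′-walk = staysIn S′-closed

    O⁺ : Sub
    O⁺ v = O v ⊎ Y v

    Z′ : Fin (suc m) → Sub
    Z′ zero    = O⁺
    Z′ (suc i) = Z i

    -- A neighbour in `Y` gives the upper bound because `f` changes by at most one. A neighbour in
    -- the older set `O` puts `u` within one step of `B`, by `O∩E⊆B` if it lies in `E` and by
    -- `frontier` otherwise.
    touch-base : ∀ {u} → A u → Touch O⁺ u → f u ≡ suc σ
    touch-base {u} (e , lt) (z , oz , a) = ≤-antisym (upper oz) lt
      where
      upper : O⁺ z → f u ≤ suc σ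
      upper (inj₂ (ez , le)) = ≤-trans (f-walk (step e a (stop ez))) (s≤s le)
      upper (inj₁ o) with E? z
      ... | yes ez = ≤-trans (f-walk (step e a (stop ez)))
                       (s≤s (≤-trans (≤-reflexive (f-base (O∩E⊆B o ez))) z≤n))
      ... | no ¬ez = ≤-trans (≤-reflexive (f-base (frontier e (O⊆S o) ¬ez a))) z≤n

    E⊆S : E ⊆ S
    E⊆S = proj₁ ∘ E⊆

    -- A shortest path to `B` is followed until it leaves `A`. From `x` on it still needs at least
    -- `suc σ` steps, which gives the bound on `i`.
    descend : ∀ {u} → A u → ∃ λ i → ∃₂ λ x z → i + suc σ ≤ f u × WalkIn G A i u x × Adj G x z × Y z × f x ≡ suc σ
    descend {u} (e , lt) with f-attained e
    ... | b , p , (k , le , w) with firstExit A? w (e , lt)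
    ...   | inj₁ w' = ⊥-elim (n≮0 (≤-trans (proj₂ (target w')) (≤-reflexive (f-base p))))
    ...   | inj₂ (i , j , x , z , eq , w' , a , ¬az , w'') =
      i , x , z , short , w' , a , yz , at
      where
      yz = source w'' , ≮⇒≥ (λ q → ¬az (source w'' , q))
      at = touch-base (target w') (z , inj₂ yz , a)
      short : i + suc σ ≤ f u
      short = begin
        i + suc σ         ≡⟨ cong (i +_) at ⟨
        i + f x           ≤⟨ +-monoʳ-≤ i (f-walk (step (proj₁ (target w')) a w'')) ⟩
        i + (suc j + f b) ≡⟨ cong (λ n → i + (suc j + n)) (f-base p) ⟩
        i + (suc j + 0)   ≡⟨ cong (i +_) (+-identityʳ (suc j)) ⟩
        i + suc j         ≡⟨ +-suc i j ⟩
        suc i + j         ≡⟨ eq ⟩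
        k                 ≤⟨ le ⟩
        f u               ∎
        where open ≤-Reasoning hiding (stop)

    ascend : ∀ {y} → Y y → ∃ λ b → B b × Reach Y y b
    ascend {y} (e , le) with f-attained e
    ... | b , p , (k , k≤ , w) = b , p , k , go w (≤-trans k≤ le)
      where
      go : ∀ {k x} → WalkIn G E k x b → k ≤ σ → WalkIn G Y k x b
      go (stop q) _ = stop (q , ≤-trans (≤-reflexive (f-base p)) z≤n)
      go (step q a w) le = step (q , ≤-trans (f-minimal p (_ , ≤-refl , step q a w)) le) a (go w (≤-trans (n≤1+n _) le))

    O⁺⊆S : O⁺ ⊆ S
    O⁺⊆S (inj₁ o) = O⊆S o
    O⁺⊆S (inj₂ y) = E⊆S (proj₁ y)

    O⁺-joined : ∀ {u w} → O⁺ u → O⁺ w → Reach O⁺ u w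
    O⁺-joined (inj₁ o) (inj₁ o') = reach-⊆ inj₁ (O-joined o o')
    O⁺-joined (inj₁ o) (inj₂ y) with ascend y
    ... | b , p , s = reach-trans {O⁺} (reach-⊆ inj₁ (O-joined o (B⊆O p))) (reach-⊆ inj₂ (reach-sym {Y} s))
    O⁺-joined (inj₂ y) o⁺ with ascend y
    O⁺-joined (inj₂ y) (inj₁ o) | b , p , s = reach-trans {O⁺} (reach-⊆ inj₂ s) (reach-⊆ inj₁ (O-joined (B⊆O p) o))
    O⁺-joined (inj₂ y) (inj₂ y') | b , p , s with ascend y'
    ... | b' , p' , s' = reach-trans {O⁺} (reach-⊆ inj₂ s)
      (reach-trans {O⁺} (reach-⊆ inj₁ (O-joined (B⊆O p) (B⊆O p'))) (reach-⊆ inj₂ (reach-sym {Y} s')))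

    O⁺∩S′ : ∀ {v} → S′ v → O⁺ v → ⊥
    O⁺∩S′ ((e , lt) , _) (inj₂ (_ , le)) = <⇒≱ lt le
    O⁺∩S′ ((e , lt) , _) (inj₁ o) = n≮0 (≤-trans lt (≤-reflexive (f-base (O∩E⊆B o e))))

    clique′ : Clique Z′
    clique′ = record
      { inhabited = λ { zero → case B-inhab of λ (b , p) → b , inj₁ (B⊆O p) ; (suc i) → inhabited i }
      ; joined = λ { zero → O⁺-joined ; (suc i) → joined i }
      ; disjoint = λ { {zero} {zero} ne _ _ → ne refl
                     ; {zero} {suc j} ne o z → apart j (O⁺⊆S o) z
                     ; {suc i} {zero} ne z o → apart i (O⁺⊆S o) z
                     ; {suc i} {suc j} ne z z' → disjoint (ne ∘ cong suc) z z' }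
      ; adjacent = λ { {zero} {zero} ne → ⊥-elim (ne refl)
                     ; {zero} {suc j} ne → case O-touches j of λ (o , p , t) → o , inj₁ p , t
                     ; {suc i} {zero} ne → case O-touches i of λ (o , p , (z , q , a)) → z , q , (o , inj₁ p , adj-flip a)
                     ; {suc i} {suc j} ne → adjacent (ne ∘ cong suc) } }
      where open Clique clique

    apart′ : ∀ i {v} → S′ v → Z′ i v → ⊥
    apart′ zero    = O⁺∩S′
    apart′ (suc i) p = apart i (E⊆S (S′⊆E p))

    rooted′ : ∀ {v} → S′ v → ∀ i → ∃ λ u → Reach S′ v u × Touch (Z′ i) u
    rooted′ p zero with descend (S′⊆A p)
    ... | i , x , z , _ , w , a , y , _ = x , (i , S′-walk w p) , (z , inj₂ y , a)
    rooted′ p (suc i) with proj₂ p i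
    ... | u , (k , w) , t = u , (k , S′-walk w p) , t

-- Colours and radii of the shells.

-- The five successive shells around a cell.  In each of them one of the three
-- colours is missing, the two sides of θ receive the other two, and consecutive
-- shells share a colour only on the same side.  Hence a monochromatic chain
-- keeps its side and stays within one of three groups of shells.
shade group : Bool → Fin 5 → Fin 3
shade false = lookup (zero ∷ᵛ suc (suc zero) ∷ᵛ suc (suc zero) ∷ᵛ suc zero ∷ᵛ suc zero ∷ᵛ []ᵛ)
shade true  = lookup (suc zero ∷ᵛ suc zero ∷ᵛ zero ∷ᵛ zero ∷ᵛ suc (suc zero) ∷ᵛ []ᵛ)
group false = lookup (zero ∷ᵛ suc zero ∷ᵛ suc zero ∷ᵛ suc (suc zero) ∷ᵛ suc (suc zero) ∷ᵛ []ᵛ)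
group true  = lookup (zero ∷ᵛ zero ∷ᵛ suc zero ∷ᵛ suc zero ∷ᵛ suc (suc zero) ∷ᵛ []ᵛ)

SameShade : Bool → Bool → Fin 5 → Fin 5 → Set
SameShade s t i j = toℕ i ≤ suc (toℕ j) → toℕ j ≤ suc (toℕ i) → shade s i ≡ shade t j →
  s ≡ t × group s i ≡ group t j

sameShade? : ∀ s t i j → Dec (SameShade s t i j)
sameShade? s t i j = (_ ≤? _) →-dec ((_ ≤? _) →-dec ((_ ≟ᶠ _) →-dec ((_ ≟ᵇ _) ×-dec (_ ≟ᶠ _))))

sameShade : ∀ s t i j → SameShade s t i j
sameShade false false = from-yes (all? λ i → all? λ j → sameShade? false false i j)
sameShade false true  = from-yes (all? λ i → all? λ j → sameShade? false true i j)
sameShade true  false = from-yes (all? λ i → all? λ j → sameShade? true false i j)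
sameShade true  true  = from-yes (all? λ i → all? λ j → sameShade? true true i j)

module Scales (r ω D : ℕ) where

  -- `ω` is the depth reached by earlier colours, and `p₁` lies one link beyond it, so excursions
  -- through earlier cells begin and end in the first shell. `R` is an excursion of length `D` with
  -- a link at either end; such excursions occur behind the cell, so beyond `σ` the shells are at
  -- least `R` wide. Within `suc r` behind the cell, vertices may be too close to it to be good at
  -- the next level.
  R p₁ p₂ σ p₃ p₄ τ : ℕ
  R  = r + (D + r)
  p₁ = ω + r
  p₂ = p₁ + r
  σ  = p₂ + r
  p₃ = (σ + suc r) + R
  p₄ = p₃ + R
  τ  = p₄ + R

  p₂≤σ : p₂ ≤ σ
  p₂≤σ = m≤m+n p₂ r

  ω≤p₁ : ω ≤ p₁
  ω≤p₁ = m≤m+n ω r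

  p₁≤p₂ : p₁ ≤ p₂
  p₁≤p₂ = m≤m+n p₁ r

  ω≤σ : ω ≤ σ
  ω≤σ = ≤-trans ω≤p₁ (≤-trans p₁≤p₂ p₂≤σ)

  σ+r≤p₃ : σ + suc r ≤ p₃
  σ+r≤p₃ = m≤m+n _ R

  p₃≤τ : p₃ ≤ τ
  p₃≤τ = ≤-trans (m≤m+n p₃ R) (m≤m+n p₄ R)

  σ+r≤τ : σ + suc r ≤ τ
  σ+r≤τ = ≤-trans σ+r≤p₃ p₃≤τ

  r≤R : r ≤ R
  r≤R = m≤m+n r _

  r+r≤R : r + r ≤ R
  r+r≤R = +-monoʳ-≤ r (m≤n+m r D)

  σ+2r≤τ : σ + (r + r) ≤ τ
  σ+2r≤τ = ≤-trans (+-mono-≤ (≤-trans (m≤m+n σ (suc r)) (≤-trans σ+r≤p₃ (m≤m+n p₃ R))) r+r≤R) ≤-refl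

  data Shell (x : ℕ) : Fin 5 → Set where
    shell₁ : x ≤ p₁ → Shell x zero
    shell₂ : p₁ < x → x ≤ p₂ → Shell x (suc zero)
    shell₃ : p₂ < x → x ≤ p₃ → Shell x (suc (suc zero))
    shell₄ : p₃ < x → x ≤ p₄ → Shell x (suc (suc (suc zero)))
    shell₅ : p₄ < x → Shell x (suc (suc (suc (suc zero))))

  shell : ∀ x → ∃ (Shell x)
  shell x with x ≤? p₁ | x ≤? p₂ | x ≤? p₃ | x ≤? p₄
  ... | yes a | _     | _     | _     = _ , shell₁ a
  ... | no a  | yes b | _     | _     = _ , shell₂ (≰⇒> a) b
  ... | no _  | no b  | yes c | _     = _ , shell₃ (≰⇒> b) c
  ... | no _  | no _  | no c  | yes d = _ , shell₄ (≰⇒> c) d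
  ... | no _  | no _  | no _  | no d  = _ , shell₅ (≰⇒> d)

  phase : ℕ → Fin 5
  phase x = proj₁ (shell x)

  inPhase : ∀ x → Shell x (phase x)
  inPhase x = proj₂ (shell x)

  p₁≤p₃ : p₁ ≤ p₃
  p₁≤p₃ = ≤-trans p₁≤p₂ (≤-trans p₂≤σ (≤-trans (m≤m+n σ (suc r)) σ+r≤p₃))

  p₂≤p₃ : p₂ ≤ p₃
  p₂≤p₃ = ≤-trans p₂≤σ (≤-trans (m≤m+n σ (suc r)) σ+r≤p₃)

  p₃≤p₄ : p₃ ≤ p₄
  p₃≤p₄ = m≤m+n p₃ R

  phase-≤₁ : ∀ {x} → x ≤ p₁ → toℕ (phase x) ≤ 0
  phase-≤₁ {x} le with phase x | inPhase x
  ... | _ | shell₁ _    = z≤n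
  ... | _ | shell₂ lt _ = ⊥-elim (<⇒≱ lt le)
  ... | _ | shell₃ lt _ = ⊥-elim (<⇒≱ lt (≤-trans le p₁≤p₂))
  ... | _ | shell₄ lt _ = ⊥-elim (<⇒≱ lt (≤-trans le p₁≤p₃))
  ... | _ | shell₅ lt   = ⊥-elim (<⇒≱ lt (≤-trans le (≤-trans p₁≤p₃ p₃≤p₄)))

  phase-≤₂ : ∀ {x} → x ≤ p₂ → toℕ (phase x) ≤ 1
  phase-≤₂ {x} le with phase x | inPhase x
  ... | _ | shell₁ _    = z≤n
  ... | _ | shell₂ _ _  = s≤s z≤n
  ... | _ | shell₃ lt _ = ⊥-elim (<⇒≱ lt le)
  ... | _ | shell₄ lt _ = ⊥-elim (<⇒≱ lt (≤-trans le p₂≤p₃))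
  ... | _ | shell₅ lt   = ⊥-elim (<⇒≱ lt (≤-trans le (≤-trans p₂≤p₃ p₃≤p₄)))

  phase-≤₃ : ∀ {x} → x ≤ p₃ → toℕ (phase x) ≤ 2
  phase-≤₃ {x} le with phase x | inPhase x
  ... | _ | shell₁ _    = z≤n
  ... | _ | shell₂ _ _  = s≤s z≤n
  ... | _ | shell₃ _ _  = s≤s (s≤s z≤n)
  ... | _ | shell₄ lt _ = ⊥-elim (<⇒≱ lt le)
  ... | _ | shell₅ lt   = ⊥-elim (<⇒≱ lt (≤-trans le p₃≤p₄))

  phase-≤₄ : ∀ {x} → x ≤ p₄ → toℕ (phase x) ≤ 3
  phase-≤₄ {x} le with phase x | inPhase x
  ... | _ | shell₁ _    = z≤n
  ... | _ | shell₂ _ _  = s≤s z≤n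
  ... | _ | shell₃ _ _  = s≤s (s≤s z≤n)
  ... | _ | shell₄ _ _  = s≤s (s≤s (s≤s z≤n))
  ... | _ | shell₅ lt   = ⊥-elim (<⇒≱ lt le)

  phase-top : ∀ x → toℕ (phase x) ≤ 4
  phase-top x with phase x
  ... | zero                     = z≤n
  ... | suc zero                 = s≤s z≤n
  ... | suc (suc zero)           = s≤s (s≤s z≤n)
  ... | suc (suc (suc zero))     = s≤s (s≤s (s≤s z≤n))
  ... | suc (suc (suc (suc zero))) = s≤s (s≤s (s≤s (s≤s z≤n)))

  phase-next : ∀ {x y} → (y ≤ p₁ → x ≤ p₂) → (y ≤ p₂ → x ≤ p₃) → (y ≤ p₃ → x ≤ p₄) →
    toℕ (phase x) ≤ suc (toℕ (phase y))
  phase-next {x} {y} h₁ h₂ h₃ with phase y | inPhase y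
  ... | _ | shell₁ le   = phase-≤₂ {x} (h₁ le)
  ... | _ | shell₂ _ le = phase-≤₃ {x} (h₂ le)
  ... | _ | shell₃ _ le = phase-≤₄ {x} (h₃ le)
  ... | _ | shell₄ _ _  = phase-top x
  ... | _ | shell₅ _    = ≤-trans (phase-top x) (n≤1+n 4)

  p₂+r≤p₃ : p₂ + r ≤ p₃
  p₂+r≤p₃ = ≤-trans (m≤m+n σ (suc r)) σ+r≤p₃

  phase-near : ∀ {x y} → x ≤ r + y → toℕ (phase x) ≤ suc (toℕ (phase y))
  phase-near {x} {y} le = phase-next
    (λ h → ≤-trans le (≤-trans (+-monoʳ-≤ r h) (≤-reflexive (+-comm r p₁))))
    (λ h → ≤-trans le (≤-trans (+-monoʳ-≤ r h) (≤-trans (≤-reflexive (+-comm r p₂)) p₂+r≤p₃)))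
    (λ h → ≤-trans le (≤-trans (+-mono-≤ r≤R h) (≤-reflexive (+-comm R p₃))))

  phase-far : ∀ {x y} → σ < y → x ≤ R + y → toℕ (phase x) ≤ suc (toℕ (phase y))
  phase-far {x} {y} lt le = phase-next
    (λ h → ⊥-elim (<⇒≱ lt (≤-trans h (≤-trans p₁≤p₂ p₂≤σ))))
    (λ h → ⊥-elim (<⇒≱ lt (≤-trans h p₂≤σ)))
    (λ h → ≤-trans le (≤-trans (+-monoʳ-≤ R h) (≤-reflexive (+-comm R p₃))))

  phase-low : ∀ {x y} → x ≤ p₁ → toℕ (phase x) ≤ suc (toℕ (phase y))
  phase-low {x} le = ≤-trans (phase-≤₁ {x} le) z≤n

  inner : ∀ {s x} → group s (phase x) ≡ zero → x ≤ p₂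
  inner {s} {x} e with phase x | inPhase x
  ... | _ | shell₁ le = ≤-trans le p₁≤p₂
  ... | _ | shell₂ _ le = le
  inner {false} () | _ | shell₃ _ _
  inner {true}  () | _ | shell₃ _ _
  inner {false} () | _ | shell₄ _ _
  inner {true}  () | _ | shell₄ _ _
  inner {false} () | _ | shell₅ _
  inner {true}  () | _ | shell₅ _

  innermost : ∀ {s x} → x ≤ p₁ → group s (phase x) ≡ zero
  innermost {s} {x} le with phase x | inPhase x
  innermost {false} _  | _ | shell₁ _ = refl
  innermost {true}  _  | _ | shell₁ _ = refl
  innermost le         | _ | shell₂ lt _ = ⊥-elim (<⇒≱ lt le)
  innermost le         | _ | shell₃ lt _ = ⊥-elim (<⇒≱ lt (≤-trans le p₁≤p₂))
  innermost le         | _ | shell₄ lt _ = ⊥-elim (<⇒≱ lt (≤-trans le p₁≤p₃))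
  innermost le         | _ | shell₅ lt   = ⊥-elim (<⇒≱ lt (≤-trans le (≤-trans p₁≤p₃ p₃≤p₄)))

  -- The fifth shell shares no group with the first three. In `barrier`, `x` is the depth at the end
  -- of a chain and `y` the depth at its start.
  innerOrOuter : ∀ s t x y → group s (phase x) ≡ group t (phase y) → x ≤ p₄ ⊎ p₃ < y
  innerOrOuter s t x y e with phase x | inPhase x | phase y | inPhase y
  ... | _ | shell₁ le   | _ | _ = inj₁ (≤-trans le (≤-trans p₁≤p₃ p₃≤p₄))
  ... | _ | shell₂ _ le | _ | _ = inj₁ (≤-trans le (≤-trans p₂≤p₃ p₃≤p₄))
  ... | _ | shell₃ _ le | _ | _ = inj₁ (≤-trans le p₃≤p₄)
  ... | _ | shell₄ _ le | _ | _ = inj₁ le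
  ... | _ | _ | _ | shell₄ lt _ = inj₂ lt
  ... | _ | _ | _ | shell₅ lt = inj₂ (≤-trans (s≤s p₃≤p₄) lt)
  innerOrOuter false false x y () | _ | shell₅ _ | _ | shell₁ _
  innerOrOuter false true  x y () | _ | shell₅ _ | _ | shell₁ _
  innerOrOuter true  false x y () | _ | shell₅ _ | _ | shell₁ _
  innerOrOuter true  true  x y () | _ | shell₅ _ | _ | shell₁ _
  innerOrOuter false false x y () | _ | shell₅ _ | _ | shell₂ _ _
  innerOrOuter false true  x y () | _ | shell₅ _ | _ | shell₂ _ _
  innerOrOuter true  false x y () | _ | shell₅ _ | _ | shell₂ _ _
  innerOrOuter true  true  x y () | _ | shell₅ _ | _ | shell₂ _ _
  innerOrOuter false false x y () | _ | shell₅ _ | _ | shell₃ _ _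
  innerOrOuter false true  x y () | _ | shell₅ _ | _ | shell₃ _ _
  innerOrOuter true  false x y () | _ | shell₅ _ | _ | shell₃ _ _
  innerOrOuter true  true  x y () | _ | shell₅ _ | _ | shell₃ _ _

-- A component that has lost contact with its cell satisfies the bounds of the
-- deeper level again, so nothing deteriorates from one cell to the next.
pending : ℕ → Bounds → Bounds
pending m c = record c { len = len c + suc m }

module Widths (r m : ℕ) (c : Bounds) where
  open Scales r (rim c) (diam c) public

  -- A cell vertex is within `τ` of `B`, hence within `τ + thick c` of a geodesic. A vertex one link
  -- away from a growing earlier chain is within `r + off c` of the geodesic of that chain. `Λ`
  -- exceeds both.
  Λ q : ℕ
  Λ = (τ + thick c) + (r + off c)
  q = zoneBound Λ R (len (pending m c))

  -- `len` allows for the concatenated lists of `sink`, `thick` for frontier vertices at depth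
  -- `suc σ`, just outside the cell, and `rim` for colours down to `τ`. `diam` is a zone of size `q`
  -- with an excursion of length `diam c` and a link at either end.
  bounds : Bounds
  bounds = record
    { len   = len (pending m c) + len c
    ; thick = suc σ + thick c
    ; rim   = τ + rim c
    ; diam  = (diam c + r) + (q + (diam c + r))
    ; off   = ((diam c + r) + (q + Λ)) + off c
    }

-- Extending a partial decomposition by one cell.

module Steps (G : Graph) (r : ℕ) where
  open Walks G
  open Zones G
  open Levels G r

  next : ℕ → Bounds → Bounds
  next m c = Widths.bounds r m c

  module Recolour {m} (Z : Fin m → Sub) (S : Sub) (clique : Clique Z) (apart : ∀ i {v} → S v → Z i v → ⊥)
      (c : Bounds) {M W χ v₀}
      (partial : Stage.Partial Z S (diam (next m c)) M W χ)
      (exit : Stage.Exit Z S (pending m c) M W χ v₀)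
      (E? : ∀ v → Dec (Stage.Exit.E exit v))
      (f : V G → ℕ)
      (f-attained : ∀ {v} → Stage.Exit.E exit v → ∃ λ b → Stage.Exit.B exit b × Dist (Stage.Exit.E exit) (f v) v b)
      (f-minimal : ∀ {v b k} → Stage.Exit.B exit b → Dist (Stage.Exit.E exit) k v b → f v ≤ k) where

    open Widths r m c hiding (bounds)
    open Stage Z S
    open Partial partial
    open Exit exit
    open Cell Z S clique apart σ exit E? f f-attained f-minimal public
    module Behind = Stage Z′ S′

    D : ℕ
    D = diam c

    -- The additional set `O⁺` is left out: a component that loses only `O⁺` is not finished at this
    -- level and needs further cells.
    Esc : Sub → V G → Set
    Esc M′ v = ∃ λ (i : Fin m) → ∀ u → Reach (Behind.Outside M′) v u → ¬ Touch (Z i) u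

    module Paint (out : Behind.Output c)
        (W? : ∀ v → Dec (W v)) (S′? : ∀ v → Dec (S′ v))
        (W′? : ∀ v → Dec (Behind.Output.W out v)) (M′? : ∀ v → Dec (Behind.Output.M out v))
        (Esc? : ∀ v → Dec (Esc (Behind.Output.M out) v))
        (near? : Near? Λ es) (θ : V G → Bool) (zoned : Zoned Λ R q es θ) where

      open Behind.Output out using (exits) renaming (M to M′; W to W′; χ to χ′; partial to partial′)
      open Behind.Partial partial′ using () renaming
        (M⊆W to M′⊆W′; W⊆S to W′⊆S′; wide to wide′; bounded to bounded′; block to block′)

      Out′ : Sub
      Out′ = Behind.Outside M′

      Out′? : ∀ v → Dec (Out′ v)
      Out′? v = S′? v ×-dec ¬? (M′? v)

      -- F is coloured by the shells of the cell, H as in the decomposition behind it.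
      F H Mₙ Wₙ : Sub
      F v = E v × ¬ W v × (f v ≤ σ + suc r ⊎ (f v ≤ τ × (¬ S′ v ⊎ (¬ W′ v × Esc M′ v))))
      H v = S′ v × W′ v × σ + suc r < f v
      Mₙ v = M v ⊎ Y v ⊎ M′ v
      Wₙ v = W v ⊎ F v ⊎ H v

      F? : ∀ v → Dec (F v)
      F? v = E? v ×-dec ¬? (W? v) ×-dec ((f v ≤? σ + suc r) ⊎-dec
        ((f v ≤? τ) ×-dec (¬? (S′? v) ⊎-dec (¬? (W′? v) ×-dec Esc? v))))

      H? : ∀ v → Dec (H v)
      H? v = S′? v ×-dec (W′? v ×-dec (suc (σ + suc r) ≤? f v))

      χₙ : V G → Fin 3
      χₙ v with W? v | H? v
      ... | yes _ | _     = χ v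
      ... | no _  | yes _ = χ′ v
      ... | no _  | no _  = shade (θ v) (phase (f v))

      low : ∀ {v} → E v → W v → f v ≤ rim c
      low e w with rim-near w e
      ... | b , p , d = f-minimal p d

      H⊆E : H ⊆ E
      H⊆E = S′⊆E ∘ proj₁

      A∩W : ∀ {v} → A v → W v → ⊥
      A∩W (e , lt) w = <⇒≱ lt (≤-trans (low e w) ω≤σ)

      H∩W : ∀ {v} → H v → W v → ⊥
      H∩W h = A∩W (S′⊆A (proj₁ h))

      F∩H : ∀ {v} → F v → H v → ⊥
      F∩H (_ , _ , inj₁ le) (_ , _ , lt) = <⇒≱ lt le
      F∩H (_ , _ , inj₂ (_ , inj₁ ¬s)) (s , _) = ¬s s
      F∩H (_ , _ , inj₂ (_ , inj₂ (¬w , _))) (_ , w , _) = ¬w w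

      χ-old : ∀ {v} → W v → χₙ v ≡ χ v
      χ-old {v} w with W? v
      ... | yes _ = refl
      ... | no ¬w = ⊥-elim (¬w w)

      χ-behind : ∀ {v} → H v → χₙ v ≡ χ′ v
      χ-behind {v} h with W? v | H? v
      ... | yes w | _     = ⊥-elim (H∩W h w)
      ... | no _  | yes _ = refl
      ... | no _  | no ¬h = ⊥-elim (¬h h)

      χ-cell : ∀ {v} → F v → χₙ v ≡ shade (θ v) (phase (f v))
      χ-cell {v} p with W? v | H? v
      ... | yes w | _     = ⊥-elim (proj₁ (proj₂ p) w)
      ... | no _  | yes h = ⊥-elim (F∩H p h)
      ... | no _  | no _  = refl

      f-top : ∀ {v} → F v → f v ≤ τ
      f-top (_ , _ , inj₁ le) = ≤-trans le σ+r≤τ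
      f-top (_ , _ , inj₂ (le , _)) = le

      New : Sub
      New v = F v ⊎ H v

      New⊆E : New ⊆ E
      New⊆E (inj₁ p) = proj₁ p
      New⊆E (inj₂ h) = H⊆E h

      New∩W : ∀ {v} → New v → W v → ⊥
      New∩W (inj₁ p) = proj₁ (proj₂ p)
      New∩W (inj₂ h) = H∩W h

      Linkₙ Link₀ : V G → V G → Set
      Linkₙ = Link Wₙ χₙ
      Link₀ = Link W χ

      Link′ : V G → V G → Set
      Link′ = Behind.Link W′ χ′

      linkₙ-sym : ∀ {u v} → Linkₙ u v → Linkₙ v u
      linkₙ-sym = link-sym

      open Chains Linkₙ linkₙ-sym F F?

      -- Guarded vertices are joined to uncoloured ones, hence far from M.
      Guard : V G → Set
      Guard u = E u × Good u × (New u ⊎ (W u × (∃₂ λ w y → Star Link₀ u w × S y × ¬ W y × Dist S r w y)))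

      far : ∀ {u z} → Guard u → M z → Dist S (r + r) u z → ⊥
      far (e , g , inj₁ n) p d = New∩W n (wide (E⊆S e) p d)
      far (e , g , inj₂ (w , x , y , s , sy , ¬wy , d')) p d = block w g p d s sy ¬wy d'

      toE : ∀ {k u v} → Guard u → k ≤ r + r → Dist S k u v → Dist E k u v
      toE g le (j , j≤ , w) = j , j≤ , staysIn (λ e o a → E-closed e o a)
        (avoiding (λ p d → far g p (dist-≤ {S} (≤-trans j≤ le) d)) w) (proj₁ g)

      guard-step : ∀ {u v} → Guard u → Linkₙ u v → Guard v × Dist E r u v
      guard-step {u} {v} g ((wu , gu) , (wv , gv) , eq , d) = (target (proj₂ (proj₂ d')) , gv , status wv) , d'
        where
        d' = toE g (m≤m+n r r) d
        status : Wₙ v → New v ⊎ (W v × (∃₂ λ w y → Star Link₀ v w × S y × ¬ W y × Dist S r w y))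
        status (inj₂ n) = inj₁ n
        status (inj₁ w) = old g w
          where
          old : Guard u → W v → New v ⊎ (W v × (∃₂ λ w y → Star Link₀ v w × S y × ¬ W y × Dist S r w y))
          old (e , _ , inj₁ n) w = inj₂ (w , v , u , ε , E⊆S e , New∩W n , dist-sym {S} d)
          old (e , _ , inj₂ (wu' , x , y , s , rest)) w =
            inj₂ (w , x , y , ((w , gv) , (wu' , gu) , trans (sym (χ-old w)) (trans (sym eq) (χ-old wu')) , dist-sym {S} d) ◅ s , rest)

      guard-chain : ∀ {u v} → Guard u → Star Linkₙ u v → Guard v
      guard-chain g ε       = g
      guard-chain g (l ◅ s) = guard-chain (proj₁ (guard-step g l)) s

      guard-off : ∀ {u v} → Guard u → Star Off u v → Guard v
      guard-off g s = guard-chain g (Star.map proj₁ s)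

      new-guard : ∀ {v} → New v → Good v → Guard v
      new-guard n g = New⊆E n , g , inj₁ n

      -- A chain without new vertices keeps its old bound. Otherwise its first new vertex was
      -- uncoloured before, so the old part in front of it is guarded.
      split : ∀ {u v} → Wₙ u → Good u → Star Linkₙ u v → (W u × Star Link₀ u v) ⊎ Guard u
      split (inj₂ n) g ε       = inj₂ (new-guard n g)
      split (inj₁ w) g ε       = inj₁ (w , ε)
      split (inj₂ n) g (l ◅ s) = inj₂ (new-guard n g)
      split (inj₁ w) g (l@(p , (wx , gx) , eq , d) ◅ s) with split wx gx s
      ... | inj₂ gd = inj₂ (proj₁ (guard-step gd (linkₙ-sym l)))
      ... | inj₁ (w' , s') = inj₁ (w , ((w , g) , (w' , gx) , trans (sym (χ-old w)) (trans eq (χ-old w')) , d) ◅ s')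

      -- `O⁺` is touched only at depth `suc σ`, and `H` begins more than `r` beyond that depth.
      good-behind : ∀ {u} → H u → Good u → Behind.Good u
      good-behind h g zero (x , d , t) = <⇒≱ (proj₂ (proj₂ h))
        (≤-trans (f-dist (dist-⊆ S′⊆E d)) (≤-reflexive (trans (cong (r +_) (touch-base (S′⊆A (target (proj₂ (proj₂ d)))) t))
          (trans (+-suc r σ) (trans (cong suc (+-comm r σ)) (sym (+-suc σ r)))))))
      good-behind h g (suc i) (x , d , t) = g i (x , dist-⊆ (E⊆S ∘ S′⊆E) d , t)

      deepS′ : ∀ {k u v} → S′ u → σ + k < f u → Dist E k u v → Dist S′ k u v
      deepS′ {k} s lt (j , j≤ , w) = j , j≤ , S′-walk (deep w (≤-trans (s≤s (+-monoʳ-≤ σ j≤)) lt)) s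

      σr : ∀ {x} → σ + suc r < x → σ + r < x
      σr lt = ≤-trans (s≤s (+-monoʳ-≤ σ (n≤1+n r))) lt

      climb : ∀ {x y} → σ + suc r < x → x ≤ r + y → σ < y
      climb {x} {y} lt le = linear 1 (lt ⊕ le) (identity x y σ r)
        where
        identity : ∀ x y σ r → (suc σ + (x + (r + y))) + 1 ≡ y + (suc (σ + suc r) + x)
        identity = solve-∀

      behind-step : ∀ {u v} → Guard u → H u → H v → Linkₙ u v → Link′ u v
      behind-step gd hu hv l@((_ , gu) , (_ , gv) , eq , _) =
        (proj₁ (proj₂ hu) , good-behind hu gu) , (proj₁ (proj₂ hv) , good-behind hv gv) ,
        trans (sym (χ-behind hu)) (trans eq (χ-behind hv)) ,
        deepS′ (proj₁ hu) (σr (proj₂ (proj₂ hu))) (proj₂ (guard-step gd l))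

      f-step : ∀ {u v} → Guard u → Linkₙ u v → f u ≤ r + f v
      f-step g l = f-dist (proj₂ (guard-step g l))

      f-step′ : ∀ {u v} → Guard u → Linkₙ u v → f v ≤ r + f u
      f-step′ g l = f-dist (dist-sym {E} (proj₂ (guard-step g l)))

      -- Outside `F` a chain cannot pass between `W` and `H`: the depths are at most `ω` in the one
      -- and above `σ + suc r` in the other, more than a link apart.
      off-behind : ∀ {u v} → Guard u → H u → Star Off u v → H v × Star Link′ u v
      off-behind g h ε = h , ε
      off-behind g h ((l@(_ , (wv , _) , _) , ¬u , ¬v) ◅ s) with wv
      ... | inj₂ (inj₁ p) = ⊥-elim (¬v p)
      ... | inj₂ (inj₂ h') = case off-behind (proj₁ (guard-step g l)) h' s of λ (h'' , s') →
        h'' , behind-step g h h' l ◅ s'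
      ... | inj₁ w = ⊥-elim (<⇒≱ (σr (proj₂ (proj₂ h))) (≤-trans (f-step g l)
        (≤-trans (+-monoʳ-≤ r (≤-trans (low (proj₁ (proj₁ (guard-step g l))) w) ω≤σ)) (≤-reflexive (+-comm r σ)))))

      off-old : ∀ {u v} → Guard u → W u → Star Off u v → W v × Star Link₀ u v
      off-old g w ε = w , ε
      off-old g w ((l@((_ , gu) , (wv , gv) , eq , d) , ¬u , ¬v) ◅ s) with wv
      ... | inj₂ (inj₁ p) = ⊥-elim (¬v p)
      ... | inj₁ w' = case off-old (proj₁ (guard-step g l)) w' s of λ (w'' , s') →
        w'' , ((w , gu) , (w' , gv) , trans (sym (χ-old w)) (trans eq (χ-old w')) , d) ◅ s'
      ... | inj₂ (inj₂ h) = ⊥-elim (<⇒≱ (σr (proj₂ (proj₂ h))) (≤-trans (f-step′ g l)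
        (≤-trans (+-monoʳ-≤ r (≤-trans (low (proj₁ g) w) ω≤σ)) (≤-reflexive (+-comm r σ)))))

      distH : ∀ {u v} → Guard u → H u → Star Off u v → Dist S′ D u v
      distH g h s = bounded′ (proj₁ (proj₂ h)) (good-behind h (proj₁ (proj₂ g))) (proj₂ (off-behind g h s))

      covered : ∀ {k u} → E u → f u ≤ k → Any (λ e → Near (k + thick c) e u) es
      covered {k} {u} e le with f-attained e
      ... | b , p , d = go es-around (B-near p)
        where
        go : ∀ {xs} → All (λ x → E ⊆ dom x) xs → Any (λ x → Near (thick c) x b) xs → Any (λ x → Near (k + thick c) x u) xs
        go {x ∷ _} (i ∷ _) (here n)  = here (near-shift {e = x} (dist-mono i le d) n)
        go         (_ ∷ is) (there n) = there (go is n)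

      coveredΛ : ∀ {u} → F u → Covered Λ es u
      coveredΛ p = Any.map (λ {x} → near-≤ {e = x} (m≤m+n (τ + thick c) _)) (covered (proj₁ p) (f-top p))

      insideS : ∀ {k u v} {Q : Geodesic → Set} → Any (λ e → Dist (dom e) k u v × Q e) es → Dist S k u v
      insideS a with anyAll es-inside a
      ... | e , i , d , _ = dist-⊆ i d

      wₙ : ∀ {u v} → Linkₙ u v → Wₙ v
      wₙ (_ , (w , _) , _) = w

      -- What a hop reveals about depths. After an excursion through earlier cells no distance in
      -- `E` is known, only that both ends lie in the first shell; after one behind the cell both
      -- ends lie beyond `σ`, where shells are wide enough.
      data Between (a b : V G) : Set where
        direct : Dist E r a b → Between a b
        lower  : f a ≤ p₁ → f b ≤ p₁ → Between a b
        upper  : σ < f a → σ < f b → Dist E R a b → Between a b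

      data Entering (x a : V G) : Set where
        equal  : x ≡ a → Entering x a
        above  : H x → (u : V G) → H u → Star Link′ x u → Dist E r u a → Guard u → Entering x a
        below  : W x → (u : V G) → Star Link₀ x u → W u → f a ≤ p₁ → Dist S r u a → Entering x a

      entering : ∀ {x a} → Guard x → Wₙ x → F a → Enter x a → Entering x a
      entering g w p (inj₁ e) = equal e
      entering g (inj₂ (inj₁ q)) p (inj₂ (u , ¬x , _)) = ⊥-elim (¬x q)
      entering g (inj₂ (inj₂ h)) p (inj₂ (u , ¬x , s , ¬u , l)) with off-behind g h s
      ... | h' , s' = above h u h' s' (proj₂ (guard-step g' l)) g'
        where g' = guard-off g s
      entering g (inj₁ w) p (inj₂ (u , ¬x , s , ¬u , l)) with off-old g w s
      ... | w' , s' = below w u s' w' (≤-trans (f-step′ g' l)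
          (≤-trans (+-monoʳ-≤ r (low (proj₁ g') w')) (≤-reflexive (+-comm r (rim c))))) (proj₂ (proj₂ (proj₂ l)))
        where g' = guard-off g s

      dist-above : ∀ {x u a} → Guard x → H x → Star Link′ x u → Dist E r u a → Dist E (D + r) x a
      dist-above g h s d = dist-trans {E} (dist-⊆ S′⊆E (bounded′ (proj₁ (proj₂ h)) (good-behind h (proj₁ (proj₂ g))) s)) d

      hop-guard : ∀ {a b} → Guard a → Hop a b → Guard b
      hop-guard g (_ , _ , inj₁ l) = proj₁ (guard-step g l)
      hop-guard g (_ , _ , inj₂ (u , v , l , _ , s , _ , l')) =
        proj₁ (guard-step (guard-off (proj₁ (guard-step g l)) s) l')

      hop-colour : ∀ {a b} → Hop a b → χₙ a ≡ χₙ b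
      hop-colour (_ , _ , inj₁ (_ , _ , eq , _)) = eq
      hop-colour (_ , _ , inj₂ (u , v , (_ , _ , eq , _) , _ , s , _ , (_ , _ , eq' , _))) =
        trans eq (trans (Star.fold (λ x y → χₙ x ≡ χₙ y) (λ ((_ , _ , h , _) , _) → trans h) refl s) eq')

      hop : ∀ {a b} → Guard a → Hop a b → Jump Λ R es a b × Between a b
      hop g (p , p' , inj₁ l) with proj₂ (guard-step g l)
      ... | d = jump-inside near? es-around (dist-≤ {E} r≤R d) (coveredΛ p) , direct d
      hop {a} {b} g (p , p' , inj₂ (u , v , l , ¬u , s , ¬v , l')) = go (wₙ l)
        where
        gu = proj₁ (guard-step g l)
        gv = guard-off gu s
        gb = proj₁ (guard-step gv l')
        go : Wₙ u → Jump Λ R es a b × Between a b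
        go (inj₂ (inj₁ q)) = ⊥-elim (¬u q)
        go (inj₂ (inj₂ h)) =
          jump-inside near? es-around d (coveredΛ p) ,
          upper (climb (proj₂ (proj₂ h)) (f-step′ g l))
                (climb (proj₂ (proj₂ (proj₁ (off-behind gu h s)))) (f-step gv l')) d
          where
          d : Dist E R a b
          d = dist-trans {E} (proj₂ (guard-step g l))
            (dist-trans {E} (dist-⊆ S′⊆E (distH gu h s)) (proj₂ (guard-step gv l')))
        go (inj₁ w) with off-old gu w s
        ... | w' , s' =
          -- The end `b` was uncoloured before this cell and is within `r` of the earlier chain, so
          -- that chain was still growing and `local` applies to it.
          jump-along near? es-nested (along es-around (local (proj₁ gu) w (proj₁ (proj₂ gu)) s' (E⊆S (proj₁ p'))
            (proj₁ (proj₂ p')) (proj₂ (proj₂ (proj₂ l'))))) ,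
          lower (≤-trans (f-step g l) (lowered gu w)) (≤-trans (f-step′ gv l') (lowered gv w'))
          where
          lowered : ∀ {x} → Guard x → W x → r + f x ≤ p₁
          lowered gx wx = ≤-trans (+-monoʳ-≤ r (low (proj₁ gx) wx)) (≤-reflexive (+-comm r (rim c)))
          along : ∀ {xs} → All (λ e → E ⊆ dom e) xs →
            Any (λ e → (∀ t → Star Link₀ u t → Dist (dom e) D u t) × Near (off c) e u) xs →
            Any (λ e → Near Λ e a × Dist (dom e) R a b) xs
          along {e ∷ _} (i ∷ _) (here (d , n)) = here
            ( near-≤ {e = e} (m≤n+m (r + off c) (τ + thick c)) (near-shift {e = e} (dist-⊆ i (proj₂ (guard-step g l))) n)
            , dist-trans {dom e} (dist-⊆ i (proj₂ (guard-step g l)))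
                (dist-trans {dom e} (d v s') (dist-⊆ i (proj₂ (guard-step gv l')))) )
          along (_ ∷ is) (there x) = there (along is x)

      phases : ∀ {a b} → Between a b → toℕ (phase (f a)) ≤ suc (toℕ (phase (f b)))
      phases {a} {b} (direct d)    = phase-near {f a} {f b} (f-dist d)
      phases {a} {b} (lower la _)  = phase-low {f a} {f b} la
      phases {a} {b} (upper _ lt d) = phase-far {f a} {f b} lt (f-dist d)

      between-sym : ∀ {a b} → Between a b → Between b a
      between-sym (direct d)      = direct (dist-sym {E} d)
      between-sym (lower p q)     = lower q p
      between-sym (upper p q d)   = upper q p (dist-sym {E} d)

      group-of : V G → Fin 3
      group-of a = group (θ a) (phase (f a))

      hop-same : ∀ {a b} → Guard a → Hop a b → θ a ≡ θ b × group-of a ≡ group-of b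
      hop-same {a} {b} g h@(p , p' , _) = sameShade (θ a) (θ b) (phase (f a)) (phase (f b))
        (phases bt) (phases (between-sym bt)) (trans (sym (χ-cell p)) (trans (hop-colour h) (χ-cell p')))
        where bt = proj₂ (hop g h)

      hops-group : ∀ {a b} → Guard a → Star Hop a b → group-of a ≡ group-of b
      hops-group g ε = refl
      hops-group g (h ◅ s) = trans (proj₂ (hop-same g h)) (hops-group (hop-guard g h) s)

      hops-zone : ∀ {a b} → Guard a → Star Hop a b → Star (ZLink Λ R es θ) a b
      hops-zone g ε = ε
      hops-zone g (h@(p , p' , _) ◅ s) =
        (coveredΛ p , coveredΛ p' , proj₁ (hop g h) , proj₁ (hop-same g h)) ◅ hops-zone (hop-guard g h) s

      Misses : V G → Set
      Misses v = ∀ u → Reach Out′ v u → ¬ Touch O⁺ u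

      escape : ∀ {v} → Out′ v → Esc M′ v ⊎ Misses v
      escape o with proj₂ (exits _ o)
      ... | zero  , h = inj₂ h
      ... | suc i , h = inj₁ (i , h)

      esc-back : ∀ {u v} → Reach Out′ u v → Esc M′ v → Esc M′ u
      esc-back s (i , h) = i , λ x t → h x (reach-trans {Out′} (reach-sym {Out′} s) t)

      misses-on : ∀ {u v} → Reach Out′ u v → Misses u → Misses v
      misses-on s h x t = h x (reach-trans {Out′} s t)

      -- The descent to the cell takes at most `k` steps inside `S′`. Either it meets `M′`, or it
      -- stays in the component of `v` outside `M′` and so witnesses contact with `O⁺`.
      toBase : ∀ {k v} → Out′ v → f v ≤ k + suc σ →
        (∃ λ z → M′ z × Dist S′ k v z) ⊎ (∃ λ x → Reach Out′ v x × Touch O⁺ x)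
      toBase {k} o@(s , _) le with descend (S′⊆A s)
      ... | i , x , z , short , w , a , y , _ with firstExit Out′? (S′-walk w s) o
      ...   | inj₁ w' = inj₂ (x , (i , w') , (z , inj₂ y , a))
      ...   | inj₂ (i' , j , u , x' , eq , w' , b , ¬o , w'') with M′? x'
      ...     | no ¬m = ⊥-elim (¬o (source w'' , ¬m))
      ...     | yes p = inj₁ (x' , p , suc i' ,
                  ≤-trans (≤-trans (m≤m+n (suc i') j) (≤-reflexive eq)) (+-cancelʳ-≤ (suc σ) i k (≤-trans short le)) ,
                  snoc (mapWalk proj₁ w') b (source w''))

      σ+2r : ∀ {x} → x ≤ σ + (r + r) → x ≤ (r + r) + suc σ
      σ+2r le = ≤-trans le (≤-trans (≤-reflexive (+-comm σ (r + r))) (+-monoʳ-≤ (r + r) (n≤1+n σ)))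

      behindM : ∀ {v z} → E v → σ + (r + r) < f v → Y z ⊎ M′ z → Dist E (r + r) v z → M′ z × S′ v × Dist S′ (r + r) v z
      behindM e lt t (j , j≤ , w) = go t (deep w (≤-trans (s≤s (+-monoʳ-≤ σ j≤)) lt))
        where
        go : _ → WalkIn G A j _ _ → _
        go (inj₁ (_ , le)) w' = ⊥-elim (<⇒≱ (proj₂ (target w')) le)
        go (inj₂ p) w' = p , sv , j , j≤ , S′-walk w' sv
          where sv = S′-reach (M′⊆S′ p) (reach-sym {A} (j , w'))
                  where M′⊆S′ = λ {x} (m : M′ x) → W′⊆S′ (M′⊆W′ m)

      nearCell : ∀ {v z} → E v → ¬ W v → Y z ⊎ M′ z → Dist E (r + r) v z → New v
      nearCell {v} e ¬w t d with f v ≤? σ + suc r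
      ... | yes le = inj₁ (e , ¬w , inj₁ le)
      ... | no gt with f v ≤? σ + (r + r) | S′? v
      ...   | no gt' | _ with behindM e (≰⇒> gt') t d
      ...     | p , s , d' = inj₂ (s , wide′ s p d' , ≰⇒> gt)
      nearCell e ¬w t d | no gt | yes le | no ¬s = inj₁ (e , ¬w , inj₂ (≤-trans le σ+2r≤τ , inj₁ ¬s))
      nearCell {v} e ¬w t d | no gt | yes le | yes s with W′? v
      ... | yes w' = inj₂ (s , w' , ≰⇒> gt)
      ... | no ¬w' with toBase o (σ+2r le) | escape o
        where o = s , ¬w' ∘ M′⊆W′
      ...   | inj₁ (z , p , d') | _ = ⊥-elim (¬w' (wide′ s p d'))
      ...   | inj₂ _ | inj₁ esc = inj₁ (e , ¬w , inj₂ (≤-trans le σ+2r≤τ , inj₂ (¬w' , esc)))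
      ...   | inj₂ (x , s' , t') | inj₂ miss = ⊥-elim (miss x s' t')

      cellE : ∀ {z} → Y z ⊎ M′ z → E z
      cellE (inj₁ y) = proj₁ y
      cellE (inj₂ p) = S′⊆E (W′⊆S′ (M′⊆W′ p))

      -- The walk is traversed twice: from `v`, which is known to be far from `M`, to see that it
      -- avoids `M`, and from `z`, which is known to lie in `E`, to see that it stays in `E`.
      backE : ∀ {k v z} → (∀ {x} → M x → Dist S k v x → ⊥) → E z → Dist S k v z → Dist E k v z
      backE h e (j , j≤ , w) = j , j≤ , rev (staysIn (λ e' o a → E-closed e' o a)
        (rev (avoiding (λ p d → h p (dist-≤ {S} j≤ d)) w)) e)

      wideₙ : ∀ {v z} → S v → Mₙ z → Dist S (r + r) v z → Wₙ v
      wideₙ s (inj₁ p) d = inj₁ (wide s p d)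
      wideₙ {v} s (inj₂ t) d with W? v
      ... | yes w = inj₁ w
      ... | no ¬w with backE (λ p d' → ¬w (wide s p d')) (cellE t) d
      ...   | d'@(_ , _ , w') = inj₂ (nearCell (source w') ¬w t d')

      Mₙ⊆Wₙ : Mₙ ⊆ Wₙ
      Mₙ⊆Wₙ (inj₁ p) = inj₁ (M⊆W p)
      Mₙ⊆Wₙ {v} (inj₂ t) with W? v
      ... | yes w = inj₁ w
      ... | no ¬w = inj₂ (nearCell (cellE t) ¬w t (dist-refl {E} (cellE t)))

      Wₙ⊆S : Wₙ ⊆ S
      Wₙ⊆S (inj₁ w) = W⊆S w
      Wₙ⊆S (inj₂ n) = E⊆S (New⊆E n)

      chain-end : ∀ {u v} → Wₙ u → Star Linkₙ u v → Wₙ v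
      chain-end w ε       = w
      chain-end w (l ◅ s) = chain-end (wₙ l) s

      enter-chain : ∀ {x a} → Enter x a → Star Linkₙ x a
      enter-chain (inj₁ refl) = ε
      enter-chain (inj₂ (u , _ , s , _ , l)) = Star.map proj₁ s ◅◅ (l ◅ ε)

      enter-dist : ∀ {x a} → Guard x → Wₙ x → F a → Enter x a → Dist S (D + r) x a
      enter-dist g w p e with entering g w p e
      ... | equal refl = dist-refl {S} (E⊆S (proj₁ g))
      ... | above h u h' s d _ = dist-⊆ E⊆S (dist-above g h s d)
      ... | below w' u s w'' le d = dist-trans {S}
        (insideS (Any.map (λ (near , n) → near u s , n)
          (local (proj₁ g) w' (proj₁ (proj₂ g)) s (E⊆S (proj₁ p)) (proj₁ (proj₂ p)) d))) d

      boundedₙ : ∀ {v w} → Wₙ v → Good v → Star Linkₙ v w → Dist S (diam (next m c)) v w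
      boundedₙ {v} {w} wv gv s with split wv gv s
      ... | inj₁ (w₀ , s₀) = bounded w₀ gv s₀
      ... | inj₂ g with decompose s
      ...   | inj₁ (¬v , _ , o) = alone wv
        where
        alone : Wₙ v → Dist S (diam (next m c)) v w
        alone (inj₁ w₀)       = bounded w₀ gv (proj₂ (off-old g w₀ o))
        alone (inj₂ (inj₁ p)) = ⊥-elim (¬v p)
        alone (inj₂ (inj₂ h)) = dist-mono (E⊆S ∘ S′⊆E) (≤-trans (m≤m+n D r) (m≤m+n (D + r) _)) (distH g h o)
      ...   | inj₂ (a , b , pa , pb , e , h , e') = dist-trans {S} (enter-dist g wv pa e)
        (dist-trans {S} (insideS (Any.map (λ (near , n) → near b (hops-zone ga h) , n) (zoned a (coveredΛ pa))))
          (dist-sym {S} (enter-dist (guard-chain g s) (chain-end wv s) pb e')))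
        where ga = guard-chain g (enter-chain e)

      module Blocked {w y} (g : Guard w) (ww : Wₙ w) (sy : S y) (¬wy : ¬ Wₙ y) (d : Dist S r w y) where

        dE : Dist E r w y
        dE = toE g (m≤m+n r r) d

        ey : E y
        ey = target (proj₂ (proj₂ dE))

        deepy : σ + suc r < f y
        deepy = ≰⇒> λ le → ¬wy (inj₂ (inj₁ (ey , ¬wy ∘ inj₁ , inj₁ le)))

        fy : f y ≤ r + f w
        fy = f-dist (dist-sym {E} dE)

        ¬W′y : S′ y → ¬ W′ y
        ¬W′y s w' = ¬wy (inj₂ (inj₂ (s , w' , deepy)))

        ¬old : W w → ⊥
        ¬old w₀ = <⇒≱ (σr deepy) (≤-trans fy (≤-trans (+-monoʳ-≤ r (≤-trans (low (proj₁ g) w₀) ω≤σ)) (≤-reflexive (+-comm r σ))))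

        -- There are only two reasons why a vertex in reach of a guarded chain stays uncoloured: it
        -- is deeper than `τ`, or its component behind the cell escapes no `Z i` but has lost
        -- contact with `O⁺`, and awaits a cell of its own.
        data Type : Set where
          beyond : τ < f y → Type
          pocket : Out′ y → ¬ Esc M′ y → Misses y → Type

        type : Type
        type with f y ≤? τ | S′? y
        ... | no gt  | _     = beyond (≰⇒> gt)
        ... | yes le | no ¬s = ⊥-elim (¬wy (inj₂ (inj₁ (ey , ¬wy ∘ inj₁ , inj₂ (le , inj₁ ¬s)))))
        ... | yes le | yes s with escape (s , ¬W′y s ∘ M′⊆W′)
        ...   | inj₁ esc  = ⊥-elim (¬wy (inj₂ (inj₁ (ey , ¬wy ∘ inj₁ , inj₂ (le , inj₂ (¬W′y s , esc))))))
        ...   | inj₂ miss = pocket (s , ¬W′y s ∘ M′⊆W′)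
          (λ esc → ¬wy (inj₂ (inj₁ (ey , ¬wy ∘ inj₁ , inj₂ (le , inj₂ (¬W′y s , esc)))))) miss

        module Behindʸ (s : S′ y) where
          dS′ : Dist S′ r y w
          dS′ = deepS′ s (σr deepy) (dist-sym {E} dE)

          block-y : ∀ {u z} → Guard u → H u → Star Link′ u w → M′ z → Dist S′ (r + r) u z → ⊥
          block-y gu h s' p d' = block′ (proj₁ (proj₂ h)) (good-behind h (proj₁ (proj₂ gu))) p d' s' s (¬W′y s) (dist-sym {S′} dS′)

          reach-y : ∀ {u} → W′ u → Behind.Good u → Star Link′ u w → Reach Out′ u y
          reach-y wu gu ε = case dist-sym {S′} dS′ of λ { d'@(j , j≤ , x) → j ,
            avoiding (λ p d'' → block′ wu gu p (dist-≤ {S′} (≤-trans j≤ (m≤m+n r r)) d'') ε s (¬W′y s) (dist-sym {S′} dS′)) x }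
          reach-y wu gu (l@(_ , (wx , gx) , _ , (j , j≤ , x)) ◅ s') = reach-trans {Out′}
            (j , avoiding (λ p d'' → block′ wu gu p (dist-≤ {S′} (≤-trans j≤ (m≤m+n r r)) d'') (l ◅ s') s (¬W′y s) (dist-sym {S′} dS′)) x)
            (reach-y wx gx s')

      -- In a component missing `O⁺`, only depths up to `σ + suc r` belong to `F`. From there the
      -- descent has at most `r` steps, and as it cannot arrive at `O⁺` it meets `M′`.
      cell-near : ∀ {t} → F t → Out′ t → ¬ Esc M′ t → Misses t → ∃ λ z → M′ z × Dist S′ r t z
      cell-near (_ , _ , inj₂ (_ , inj₁ ¬s)) o ¬esc miss = ⊥-elim (¬s (proj₁ o))
      cell-near (_ , _ , inj₂ (_ , inj₂ (_ , esc))) o ¬esc miss = ⊥-elim (¬esc esc)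
      cell-near (_ , _ , inj₁ le) o ¬esc miss with toBase o (≤-trans le (≤-reflexive
        (trans (+-suc σ r) (trans (cong suc (+-comm σ r)) (sym (+-suc r σ))))))
      ... | inj₁ x = x
      ... | inj₂ (x , s , t) = ⊥-elim (miss x s t)
      -- If the chain got from `F` to the pocket of `y`, its last cell vertex `b` would lie in that
      -- pocket, hence within `r` of `M′`. Then `y`, or the chain behind the cell leading from `b`
      -- to it, is too close to `M′` for `wide′` or `block′`.
      cross : ∀ {w y b} (g : Guard w) (ww : Wₙ w) (sy : S y) (¬wy : ¬ Wₙ y) (d : Dist S r w y) →
        Out′ y → ¬ Esc M′ y → Misses y → F b → Entering w b → ⊥
      cross {w} {y} {b} g ww sy ¬wy d o ¬esc miss p en = through en
        where
        open Blocked g ww sy ¬wy d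
        open Behindʸ (proj₁ o)
        far-y : ∀ {z} → M′ z → Dist S′ (r + r) y z → ⊥
        far-y m d' = ¬W′y (proj₁ o) (wide′ (proj₁ o) m d')
        within : ∀ {u v} → (∀ {z} → M′ z → Dist S′ (r + r) u z → ⊥) → Dist S′ r u v → Reach Out′ u v
        within h (j , j≤ , x) = j , avoiding (λ m d' → h m (dist-≤ {S′} (≤-trans j≤ (m≤m+n r r)) d')) x
        near-b : Reach Out′ y b → ∃ λ z → M′ z × Dist S′ r b z
        near-b s = cell-near p (target (proj₂ s)) (¬esc ∘ esc-back s) (misses-on s miss)
        through : Entering w b → ⊥
        through (below w₀ _ _ _ _ _) = ¬old w₀
        through (equal refl) with near-b (within far-y dS′)
        ... | z , m , dz = far-y m (dist-trans {S′} dS′ dz)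
        through (above h u hu s dub gu)
          with near-b (reach-trans {Out′} (reach-sym {Out′}
            (reach-y (proj₁ (proj₂ hu)) (good-behind hu (proj₁ (proj₂ gu))) (reverse Behind.link-sym s)))
            (within (block-y gu hu (reverse Behind.link-sym s)) (deepS′ (proj₁ hu) (σr (proj₂ (proj₂ hu))) dub)))
        ... | z , m , dz = block-y gu hu (reverse Behind.link-sym s) m
          (dist-trans {S′} (deepS′ (proj₁ hu) (σr (proj₂ (proj₂ hu))) dub) dz)

      p₃-deep : ∀ {x} → p₃ < x → σ + (r + r) < x
      p₃-deep lt = ≤-trans (s≤s (≤-trans (+-monoʳ-≤ σ (+-monoˡ-≤ r (n≤1+n r)))
        (≤-trans (≤-reflexive (sym (+-assoc σ (suc r) r))) (+-monoʳ-≤ (σ + suc r) r≤R)))) lt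

      p₃-above : ∀ {x y} → p₃ < x → x ≤ (D + r) + y → σ + (r + r) < y
      p₃-above {x} {y} lt le = linear 1 (lt ⊕ le) (identity x y σ r D)
        where
        identity : ∀ x y σ r D →
          (suc (σ + (r + r)) + (x + ((D + r) + y))) + 1 ≡ y + (suc ((σ + suc r) + (r + (D + r))) + x)
        identity = solve-∀

      outerF : ∀ {a} → F a → S′ a → p₃ < f a → ¬ W′ a
      outerF (_ , _ , inj₁ le) s lt = ⊥-elim (<⇒≱ lt (≤-trans le σ+r≤p₃))
      outerF (_ , _ , inj₂ (_ , inj₁ ¬s)) s lt = ⊥-elim (¬s s)
      outerF (_ , _ , inj₂ (_ , inj₂ (¬w , _))) s lt = ¬w

      barrier : ∀ {v z w y} → Guard v → Wₙ v → Y z ⊎ M′ z → Dist E (r + r) v z → Star Linkₙ v w →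
        S y → ¬ Wₙ y → Dist S r w y → ⊥
      barrier {v} {z} {w} {y} g wv t dz s sy ¬wy dw with decompose s
      ... | inj₁ (¬v , _ , o) = alone wv
        where
        open Blocked (guard-chain g s) (chain-end wv s) sy ¬wy dw
        alone : Wₙ v → ⊥
        alone (inj₁ w₀)       = ¬old (proj₁ (off-old g w₀ o))
        alone (inj₂ (inj₁ p)) = ¬v p
        alone (inj₂ (inj₂ h)) = behind (f v ≤? σ + (r + r)) (M′? v)
          where
          hw = proj₁ (off-behind g h o)
          s' = proj₂ (off-behind g h o)
          open Behindʸ (target (proj₂ (proj₂ (deepS′ (proj₁ hw) (σr (proj₂ (proj₂ hw))) dE))))
          behind : Dec (f v ≤ σ + (r + r)) → Dec (M′ v) → ⊥
          behind (no gt) _ with behindM (proj₁ g) (≰⇒> gt) t dz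
          ... | m , _ , d' = block-y g h s' m d'
          behind (yes le) (yes m) = block-y g h s' m (dist-refl {S′} (proj₁ h))
          behind (yes le) (no ¬m) with toBase (proj₁ h , ¬m) (σ+2r le) | type
          ... | inj₁ (x , m , d') | _ = block-y g h s' m d'
          ... | inj₂ (x , rx , tx) | pocket _ _ miss = miss x (reach-trans {Out′} (reach-sym {Out′}
                  (reach-y (proj₁ (proj₂ h)) (good-behind h (proj₁ (proj₂ g))) s')) rx) tx
          ... | inj₂ _ | beyond lt = <⇒≱ lt (≤-trans (linear 0 (fy ⊕ f-dist (dist-sym {E} (dist-⊆ S′⊆E (distH g h o))) ⊕ le)
                  (identity (f y) (f w) (f v) σ r D))
                  (+-mono-≤ (+-monoˡ-≤ R (≤-trans (m≤m+n σ (suc r)) σ+r≤p₃)) r≤R))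
            where
            identity : ∀ y w v σ r D →
              (y + (r + w + (D + v) + (σ + (r + r)))) + 0 ≡ ((σ + (r + (D + r))) + r) + (y + w + v)
            identity = solve-∀
      ... | inj₂ (a , b , pa , pb , e , h , e') = shells type
        where
        gw = guard-chain g s
        ww = chain-end wv s
        open Blocked gw ww sy ¬wy dw
        ga = guard-chain g (enter-chain e)
        shells : Type → ⊥
        shells (pocket o ¬esc miss) = cross gw ww sy ¬wy dw o ¬esc miss pb (entering gw ww pb e')
        shells (beyond lt) with innerOrOuter (θ b) (θ a) (f b) (f a) (sym (hops-group ga h))
        -- The last cell vertex has depth at most `p₄`, and `y` is at most `R` deeper, hence not
        -- beyond `τ`.
        ... | inj₁ le = near (entering gw ww pb e')
          where
          tooLow : f w ≤ (D + r) + f b → ⊥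
          tooLow le' = <⇒≱ lt (≤-trans fy (≤-trans (+-monoʳ-≤ r (≤-trans le' (+-monoʳ-≤ (D + r) le)))
            (≤-reflexive (trans (sym (+-assoc r (D + r) p₄)) (+-comm R p₄)))))
          near : Entering w b → ⊥
          near (equal refl) = tooLow (m≤n+m (f b) (D + r))
          near (above h' u _ s' d _) = tooLow (f-dist (dist-above gw h' s' d))
          near (below w₀ _ _ _ _ _) = ¬old w₀
        -- The first cell vertex `a` lies beyond `p₃`, so `v` is too deep to be near `Y` and is near
        -- `M′` instead. But `a` is uncoloured in the decomposition behind, which `wide′` or
        -- `block′` forbids.
        ... | inj₂ lt' = far-out (entering g wv pa e)
          where
          far-out : Entering v a → ⊥
          far-out (below _ _ _ _ le _) = <⇒≱ lt' (≤-trans le p₁≤p₃)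
          far-out (equal refl) with behindM (proj₁ g) (p₃-deep lt') t dz
          ... | m , sv , d' = outerF pa sv lt' (wide′ sv m d')
          far-out (above h' u hu s' d gu) with behindM (proj₁ g) (p₃-above lt' (f-dist (dist-sym {E} (dist-above g h' s' d)))) t dz
          ... | m , sv , d' = block′ (proj₁ (proj₂ h')) (good-behind h' (proj₁ (proj₂ g))) m d' s' sa (outerF pa sa lt') dua
            where
            dua = deepS′ (proj₁ hu) (σr (proj₂ (proj₂ hu))) d
            sa  = target (proj₂ (proj₂ dua))

      blockₙ : ∀ {v z w y} → Wₙ v → Good v → Mₙ z → Dist S (r + r) v z → Star Linkₙ v w →
        S y → ¬ Wₙ y → Dist S r w y → ⊥
      blockₙ {v} {w = w} {y} wv gv mz dz s sy ¬wy dw = go mz (split wv gv s)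
        where
        go : _ → (W v × Star Link₀ v w) ⊎ Guard v → ⊥
        go (inj₁ m) (inj₂ g) = far g m dz
        go (inj₁ m) (inj₁ (w₀ , s₀)) = block w₀ gv m dz s₀ sy (¬wy ∘ inj₁) dw
        go (inj₂ t) (inj₂ g) = barrier g wv t (toE g ≤-refl dz) s sy ¬wy dw
        -- An old chain that sees an uncoloured vertex starts far from `M` by the old `block`; being
        -- near the new cell, it starts in `E` and is guarded after all.
        go (inj₂ t) (inj₁ (w₀ , s₀)) with backE (λ p d' → block w₀ gv p d' s₀ sy (¬wy ∘ inj₁) dw) (cellE t) dz
        ... | d'@(_ , _ , x) = barrier (source x , gv , inj₂ (w₀ , w , y , s₀ , sy , ¬wy ∘ inj₁ , dw)) wv t d' s sy ¬wy dw

      partialₙ : Partial (diam (next m c)) Mₙ Wₙ χₙ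
      partialₙ = record { M⊆W = Mₙ⊆Wₙ ; W⊆S = Wₙ⊆S ; wide = wideₙ ; bounded = boundedₙ ; block = blockₙ }

      -- Exits of the extended decomposition.

      module Exits (rooted? : ∀ v i → Dec (∃ λ u → Reach A v u × Touch (Z i) u))
          (meets? : ∀ u → Dec (∃ λ a → Star Linkₙ u a × F a)) where

        older : ∀ {v} → Outside Mₙ v → Outside M v
        older (s , ¬m) = s , ¬m ∘ inj₁

        stepA : ∀ {u w} → A u → Outside Mₙ w → Adj G u w → A w
        stepA (e , _) o@(s , ¬m) a = e' , ≰⇒> (λ le → ¬m (inj₂ (inj₁ (e' , le))))
          where e' = E-closed e (older o) a

        step′ : ∀ {u w} → Out′ u → Outside Mₙ w → Adj G u w → Out′ w
        step′ (s , _) o@(_ , ¬m) a = S′-closed s (stepA (S′⊆A s) o a) a , ¬m ∘ inj₂ ∘ inj₂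

        A⇒outside : ∀ {u} → A u → ¬ M′ u → Outside Mₙ u
        A⇒outside (e , lt) ¬m′ = E⊆S e ,
          λ { (inj₁ m) → proj₂ (E⊆ e) m ; (inj₂ (inj₁ (_ , le))) → <⇒≱ lt le ; (inj₂ (inj₂ m′)) → ¬m′ m′ }

        -- All new vertices and all guarded ones lie in `E`, so chains starting in another component
        -- are the old chains.
        keep : ∀ {c′ v} → ¬ E v → Exit c′ M W χ v → Exit c′ Mₙ Wₙ χₙ v
        keep {v = v} ¬e X = record
          { E = X.E ; B = X.B ; O = X.O ; start = X.start
          ; E⊆ = λ e → proj₁ (X.E⊆ e) , λ { (inj₁ m) → proj₂ (X.E⊆ e) m ; (inj₂ t) → apart-E e (cellE t) }
          ; E-joined = X.E-joined
          ; E-closed = λ e o a → X.E-closed e (older o) a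
          ; B⊆E = X.B⊆E ; B-inhab = X.B-inhab ; B⊆O = X.B⊆O ; O∩E⊆B = X.O∩E⊆B ; O⊆S = X.O⊆S
          ; O-joined = X.O-joined ; O-touches = X.O-touches ; frontier = X.frontier
          ; es = X.es ; es-length = X.es-length ; es-nested = X.es-nested ; es-around = X.es-around
          ; es-inside = X.es-inside ; B-near = X.B-near
          ; rim-near = λ w e → X.rim-near (old e w) e
          ; local = λ e w g s sy ¬wy d → Any.map (λ (h , n) → (λ t s' → h t (chain₀ e w g s')) , n)
              (X.local e (old e w) g (chain₀ e w g s) sy (¬wy ∘ inj₁) d)
          }
          where
          module X = Exit X
          apart-E : ∀ {u} → X.E u → E u → ⊥
          apart-E x e with X.E-joined x
          ... | _ , w = ¬e (target (staysIn (λ e' o a → E-closed e' o a) (rev (mapWalk X.E⊆ w)) e))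
          old : ∀ {u} → X.E u → Wₙ u → W u
          old x (inj₁ w) = w
          old x (inj₂ n) = ⊥-elim (apart-E x (New⊆E n))
          chain₀ : ∀ {u w} → X.E u → Wₙ u → Good u → Star Linkₙ u w → Star Link₀ u w
          chain₀ x w g s with split w g s
          ... | inj₁ (_ , s₀) = s₀
          ... | inj₂ gd = ⊥-elim (apart-E x (proj₁ gd))

        -- The first cell vertex of the chain has depth above `σ`, so the chain is not in the
        -- innermost group and cannot end in earlier cells. Hence both its ends are short in `E`,
        -- whereas an end of type `below` would be short only in `S`.
        localCell : ∀ {u a} → Guard u → Wₙ u → A u → Star Linkₙ u a → F a →
          Any (λ e → (∀ t → Star Linkₙ u t → Dist (dom e) (diam (next m c)) u t) × Near (off (next m c)) e u) es
        localCell {u} gu wu au s fa with decompose s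
        ... | inj₁ (_ , ¬a , _) = ⊥-elim (¬a fa)
        ... | inj₂ (a , _ , pa , _ , en , _ , _) = go es-around (zoned a (coveredΛ pa))
          where
          ga = guard-chain gu (enter-chain en)
          reached : Dist E (D + r) u a × σ < f a
          reached with entering gu wu pa en
          ... | equal refl = dist-refl {E} (proj₁ gu) , proj₂ au
          ... | above h x hx s' d _ = dist-above gu h s' d , climb (proj₂ (proj₂ hx)) (f-dist d)
          ... | below w _ _ _ _ _ = ⊥-elim (A∩W au w)
          back : ∀ {t b} → Wₙ t → Guard t → F b → Star Hop a b → Enter t b → Dist E (D + r) b t
          back wt gt pb h e with entering gt wt pb e
          ... | equal refl = dist-refl {E} (proj₁ gt)
          ... | above h' x hx s' d _ = dist-sym {E} (dist-above gt h' s' d)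
          ... | below _ _ _ _ le _ = ⊥-elim (<⇒≱ (proj₂ reached)
                  (≤-trans (inner {θ a} {f a} (trans (hops-group ga h) (innermost {θ _} {f _} le))) p₂≤σ))
          bound : ∀ {e t} → E ⊆ dom e → (∀ w → Star (ZLink Λ R es θ) a w → Dist (dom e) q a w) →
            Star Linkₙ u t → Dist (dom e) (diam (next m c)) u t
          bound {e} i near st with decompose st
          ... | inj₁ (¬u , _ , o) = alone wu
            where
            alone : Wₙ u → Dist (dom e) (diam (next m c)) u _
            alone (inj₁ w) = ⊥-elim (A∩W au w)
            alone (inj₂ (inj₁ p)) = ⊥-elim (¬u p)
            alone (inj₂ (inj₂ h)) = dist-mono (i ∘ S′⊆E) (≤-trans (m≤m+n D r) (m≤m+n (D + r) _)) (distH gu h o)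
          ... | inj₂ (_ , b , _ , pb , _ , _ , en') = dist-trans {dom e} (dist-⊆ i (proj₁ reached))
            (dist-trans {dom e} (near b (hops-zone ga hs)) (dist-⊆ i (back (chain-end wu st) (guard-chain gu st) pb hs en')))
            where hs = hops pa pb (reverse linkₙ-sym (enter-chain en) ◅◅ (st ◅◅ enter-chain en'))
          go : ∀ {xs} → All (λ e → E ⊆ dom e) xs →
            Any (λ e → (∀ w → Star (ZLink Λ R es θ) a w → Dist (dom e) q a w) × Near (q + Λ) e a) xs →
            Any (λ e → (∀ t → Star Linkₙ u t → Dist (dom e) (diam (next m c)) u t) × Near (off (next m c)) e u) xs
          go {e ∷ _} (i ∷ _) (here (near , n)) = here
            ((λ t → bound {e} i near) , near-≤ {e = e} (m≤m+n ((D + r) + (q + Λ)) _) (near-shift {e = e} (dist-⊆ i (proj₁ reached)) n))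
          go (_ ∷ is) (there x) = there (go is x)

        stay-new : ∀ {u} → A u → Wₙ u → New u
        stay-new a (inj₁ w) = ⊥-elim (A∩W a w)
        stay-new a (inj₂ n) = n

        frontierA : ∀ {u w} → A u → S w → ¬ A w → Adj G u w → f u ≡ suc σ
        frontierA {u} {w} au sw ¬aw a with E? w
        ... | no ¬e = ⊥-elim (n≮0 (≤-trans (proj₂ au) (≤-reflexive (f-base (frontier (proj₁ au) sw ¬e a)))))
        ... | yes e = touch-base au (w , inj₂ (e , ≮⇒≥ (λ lt → ¬aw (e , lt))) , a)

        touched : ∀ {u} → A u → f u ≡ suc σ → Touch O⁺ u
        touched au eq with descend au
        ... | zero , x , z , _ , stop _ , a , y , _ = z , inj₂ y , a
        ... | suc i , x , z , le , _ = ⊥-elim (m+n≮n i (suc σ) (≤-trans le (≤-reflexive eq)))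

        touches⁺ : ∀ i → ∃ λ o → O⁺ o × Touch (Z i) o
        touches⁺ i with O-touches i
        ... | o , p , t = o , inj₁ p , t

        hub : V G
        hub = proj₁ B-inhab

        hub-in : O⁺ hub
        hub-in = inj₁ (B⊆O (proj₂ B-inhab))

        toHub : ∀ {u} {Q : Sub} → O⁺ ⊆ Q → Q u → Touch O⁺ u → Reach Q u hub
        toHub {Q = Q} i p (z , oz , a) = reach-trans {Q} (edge {Q} p a (i oz)) (reach-⊆ i (O⁺-joined oz hub-in))

        base-near : ∀ {u} → E u → f u ≡ suc σ → Any (λ e → Near (suc σ + thick c) e u) es
        base-near e eq = covered e (≤-reflexive eq)

        -- A component of `A` outside `S′` contains no vertex of `H`. Its coloured part belongs to
        -- the cell, and the geodesics of the current exit suffice.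
        side : ∀ {v} → A v → ¬ S′ v → Exit (next m c) Mₙ Wₙ χₙ v × Escapes Mₙ v
        side {v} av ¬s = record
          { E = Eₙ ; B = Bₙ ; O = λ u → O⁺ u ⊎ Bₙ u
          ; start = reach-refl {A} av
          ; E⊆ = λ x → A⇒outside (inA x) (λ m → ¬S′ x (W′⊆S′ (M′⊆W′ m)))
          ; E-joined = λ x → joinedₙ x
          ; E-closed = λ x o a → reach-trans {A} x (edge {A} (inA x) a (stepA (inA x) o a))
          ; B⊆E = proj₁
          ; B-inhab = case descend av of λ (i , x , _ , _ , w , _ , _ , eq) → x , (i , w) , eq
          ; B⊆O = inj₂
          ; O∩E⊆B = λ { (inj₂ b) _ → b ; (inj₁ o) x → ⊥-elim (O⁺∩A o (inA x)) }
          ; O⊆S = λ { (inj₁ o) → O⁺⊆S o ; (inj₂ (x , _)) → E⊆S (proj₁ (inA x)) }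
          ; O-joined = λ p p' → reach-trans {Oₙ} (to-hub p) (reach-sym {Oₙ} (to-hub p'))
          ; O-touches = λ i → case touches⁺ i of λ (o , p , t) → o , inj₁ p , t
          ; frontier = λ x sw ¬x a → x , frontierA (inA x) sw (λ aw → ¬x (reach-trans {A} x (edge {A} (inA x) a aw))) a
          ; es = es
          ; es-length = ≤-trans es-length (m≤m+n _ _)
          ; es-nested = es-nested
          ; es-around = All.map (λ i {u} x → i (proj₁ (inA {u} x))) es-around
          ; es-inside = es-inside
          ; B-near = λ (x , eq) → base-near (proj₁ (inA x)) eq
          ; rim-near = rimₙ
          ; local = λ x w g s _ _ _ → localCell (new-guard (stay-new (inA x) w) g) w (inA x) ε (cell x w)
          } , escapesₙ
          where
          Eₙ Bₙ Oₙ : Sub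
          Eₙ = Reach A v
          Bₙ u = Eₙ u × f u ≡ suc σ
          Oₙ u = O⁺ u ⊎ Bₙ u
          inA : ∀ {u} → Eₙ u → A u
          inA (_ , w) = target w
          ¬S′ : ∀ {u} → Eₙ u → ¬ S′ u
          ¬S′ x s = ¬s (S′-reach s (reach-sym {A} x))
          closed : ∀ {u w} → Eₙ u → A w → Adj G u w → Eₙ w
          closed x aw a = reach-trans {A} x (edge {A} (inA x) a aw)
          joinedₙ : ∀ {u} → Eₙ u → Reach Eₙ v u
          joinedₙ (k , w) = k , staysIn closed w (reach-refl {A} av)
          O⁺∩A : ∀ {u} → O⁺ u → A u → ⊥
          O⁺∩A (inj₂ (_ , le)) (_ , lt) = <⇒≱ lt le
          O⁺∩A (inj₁ o) (e , lt) = n≮0 (≤-trans lt (≤-reflexive (f-base (O∩E⊆B o e))))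
          to-hub : ∀ {u} → Oₙ u → Reach Oₙ u hub
          to-hub (inj₁ o) = reach-⊆ inj₁ (O⁺-joined o hub-in)
          to-hub (inj₂ b@(x , eq)) = toHub {Q = Oₙ} inj₁ (inj₂ b) (touched (inA x) eq)
          cell : ∀ {u} → Eₙ u → Wₙ u → F u
          cell x w with stay-new (inA x) w
          ... | inj₁ p = p
          ... | inj₂ h = ⊥-elim (¬S′ x (proj₁ h))
          rimₙ : ∀ {u} → Wₙ u → Eₙ u → ∃ λ b → Bₙ b × Dist Eₙ (rim (next m c)) u b
          rimₙ w x with descend (inA x)
          ... | i , b , _ , short , wk , _ , _ , eq = b , (reach-trans {A} x (i , wk) , eq) , i ,
            ≤-trans (m≤m+n i (suc σ)) (≤-trans short (≤-trans (f-top (cell x w)) (m≤m+n τ _))) , staysIn closed wk x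
          escapesₙ : Escapes Mₙ v
          escapesₙ with ¬∀⟶∃¬ m _ (rooted? v) (λ h → ¬s (av , h))
          ... | i , ¬r = i , λ u (k , w) t → ¬r (u , (k , staysIn stepA w av) , t)

        module Pocket {v} (ov : Out′ v) where
          module X = Behind.Exit (proj₁ (exits v ov))

          inA : ∀ {u} → X.E u → A u
          inA x = S′⊆A (proj₁ (X.E⊆ x))

          reachX : ∀ {u} → X.E u → Reach Out′ v u
          reachX x = reach-⊆ X.E⊆ (X.E-joined x)

          closedX : ∀ {u w} → X.E u → Outside Mₙ w → Adj G u w → X.E w
          closedX x o a = X.E-closed x (step′ (X.E⊆ x) o a) a

          E⊆ₙ : X.E ⊆ Outside Mₙ
          E⊆ₙ x = A⇒outside (inA x) (proj₂ (X.E⊆ x))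

          frontierX : ∀ {u w} → X.E u → S w → ¬ X.E w → Adj G u w → X.B u ⊎ (X.E u × f u ≡ suc σ)
          frontierX {u} {w} x sw ¬x a with A? w
          ... | no ¬aw = inj₂ (x , frontierA (inA x) sw ¬aw a)
          ... | yes aw = inj₁ (X.frontier x (S′-closed (proj₁ (X.E⊆ x)) aw a) ¬x a)

          O⁺∪O : Sub
          O⁺∪O u = O⁺ u ⊎ X.O u

          to-hub : ∀ {u} → O⁺∪O u → Reach O⁺∪O u hub
          to-hub (inj₁ o) = reach-⊆ inj₁ (O⁺-joined o hub-in)
          to-hub (inj₂ o) with X.O-touches zero
          ... | o' , p , t = reach-trans {O⁺∪O} (reach-⊆ inj₂ (X.O-joined o p)) (toHub {Q = O⁺∪O} inj₁ (inj₂ p) t)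

          joinedₙ : ∀ {u w} → O⁺∪O u → O⁺∪O w → Reach O⁺∪O u w
          joinedₙ p p' = reach-trans {O⁺∪O} (to-hub p) (reach-sym {O⁺∪O} (to-hub p'))

          O⊆Sₙ : O⁺∪O ⊆ S
          O⊆Sₙ (inj₁ o) = O⁺⊆S o
          O⊆Sₙ (inj₂ o) = E⊆S (S′⊆E (X.O⊆S o))

          O⁺∩X : ∀ {u} → O⁺ u → X.E u → ⊥
          O⁺∩X o x = O⁺∩S′ (proj₁ (X.E⊆ x)) o

          insideX : All (λ e → dom e ⊆ S) X.es
          insideX = All.map (λ i {u} p → E⊆S (S′⊆E (i {u} p))) X.es-inside

          localX : ∀ {u w y} → X.E u → Wₙ u → Good u → (∀ a → Star Linkₙ u a → ¬ F a) → Star Linkₙ u w →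
            S y → ¬ Wₙ y → Dist S r w y →
            Any (λ e → (∀ t → Star Linkₙ u t → Dist (dom e) D u t) × Near (off c) e u) X.es
          localX {u} {w} {y} x wu gu ¬f s sy ¬wy dw = go (stay-new (inA x) wu)
            where
            offs : ∀ {x t} → Star Linkₙ u x → Star Linkₙ x t → Star Off x t
            offs p ε = ε
            offs p (l ◅ s) = (l , ¬f _ p , ¬f _ p') ◅ offs p' s
              where p' = p ◅◅ (l ◅ ε)
            go : New u → Any (λ e → (∀ t → Star Linkₙ u t → Dist (dom e) D u t) × Near (off c) e u) X.es
            go (inj₁ p) = ⊥-elim (¬f u ε p)
            go (inj₂ h) = Any.map (λ (k , n) → (λ t s' → k t (behind s')) , n)
              (X.local x (proj₁ (proj₂ h)) (good-behind h gu) (behind s) sy′ (¬W′y sy′)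
                (deepS′ (proj₁ hw) (σr (proj₂ (proj₂ hw))) dE))
              where
              g = new-guard (inj₂ h) gu
              behind : ∀ {t} → Star Linkₙ u t → Star Link′ u t
              behind s' = proj₂ (off-behind g h (offs ε s'))
              hw = proj₁ (off-behind g h (offs ε s))
              open Blocked (guard-chain g s) (chain-end wu s) sy ¬wy dw
              sy′ = target (proj₂ (proj₂ (deepS′ (proj₁ hw) (σr (proj₂ (proj₂ hw))) dE)))

          -- Such a component may border both the cell and `M′`, so its frontier needs the geodesics
          -- of both levels. The list grows here without harm, since no further cell of this level
          -- is built in the component.
          sink : Esc M′ v → Exit (next m c) Mₙ Wₙ χₙ v × Escapes Mₙ v
          sink (i , esc) = record
            { E = X.E ; B = Bₙ ; O = Oₙ
            ; start = X.start ; E⊆ = E⊆ₙ ; E-joined = X.E-joined ; E-closed = closedX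
            ; B⊆E = B⊆Eₙ
            ; B-inhab = case X.B-inhab of λ (b , p) → b , inj₁ p
            ; B⊆O = inj₂
            ; O∩E⊆B = λ { (inj₂ b) _ → b ; (inj₁ (inj₁ o)) x → ⊥-elim (O⁺∩X o x) ; (inj₁ (inj₂ o)) x → inj₁ (X.O∩E⊆B o x) }
            ; O⊆S = λ { (inj₁ o) → O⊆Sₙ o ; (inj₂ b) → E⊆S (proj₁ (inA (B⊆Eₙ b))) }
            ; O-joined = λ p p' → reach-trans {Oₙ} (to-hubₙ p) (reach-sym {Oₙ} (to-hubₙ p'))
            ; O-touches = λ j → case touches⁺ j of λ (o , p , t) → o , inj₁ (inj₁ p) , t
            ; frontier = frontierX
            ; es = es ++ X.es
            ; es-length = ≤-trans (≤-reflexive (length-++ es)) (es-length ⊕ X.es-length)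
            ; es-nested = nested-++ es-nested es-around
            ; es-around = All.++⁺ (All.map (λ i' {u} x → i' (proj₁ (inA {u} x))) es-around) X.es-around
            ; es-inside = All.++⁺ es-inside insideX
            ; B-near = λ { (inj₁ p) → Any.++⁺ʳ es (Any.map (λ {e} → near-≤ {e = e} (m≤n+m (thick c) (suc σ))) (X.B-near p))
                         ; (inj₂ (x , eq)) → Any.++⁺ˡ (base-near (proj₁ (inA x)) eq) }
            ; rim-near = λ w x → rimₙ x (stay-new (inA x) w)
            ; local = localₙ
            } , i , λ u (k , w) → esc u (k , staysIn step′ w ov)
            where
            Bₙ Oₙ : Sub
            Bₙ u = X.B u ⊎ (X.E u × f u ≡ suc σ)
            Oₙ u = O⁺∪O u ⊎ Bₙ u
            B⊆Eₙ : Bₙ ⊆ X.E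
            B⊆Eₙ (inj₁ p) = X.B⊆E p
            B⊆Eₙ (inj₂ (x , _)) = x
            to-hubₙ : ∀ {u} → Oₙ u → Reach Oₙ u hub
            to-hubₙ (inj₁ o) = reach-⊆ inj₁ (to-hub o)
            to-hubₙ (inj₂ b@(inj₂ (x , eq))) = toHub {Q = Oₙ} (inj₁ ∘ inj₁) (inj₂ b) (touched (inA x) eq)
            to-hubₙ (inj₂ (inj₁ p)) = reach-⊆ inj₁ (to-hub (inj₂ (X.B⊆O p)))
            nested-++ : ∀ {xs} → Nested xs → All (λ e → E ⊆ dom e) xs → Nested (xs ++ X.es)
            nested-++ {[]} _ _ = X.es-nested
            nested-++ {x ∷ xs} (n , ns) (i' ∷ is) =
              All.++⁺ n (All.map (λ j {u} p → i' (S′⊆E (j {u} p))) X.es-inside) , nested-++ ns is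
            rimₙ : ∀ {u} → X.E u → New u → ∃ λ b → Bₙ b × Dist X.E (rim (next m c)) u b
            rimₙ x (inj₂ h) with X.rim-near (proj₁ (proj₂ h)) x
            ... | b , p , d = b , inj₁ p , dist-≤ {X.E} (m≤n+m (rim c) τ) d
            rimₙ {u} x (inj₁ p) with descend (inA x)
            ... | k , b , z , short , w , a , y , eq with firstExit Out′? (S′-walk w (proj₁ (X.E⊆ x))) (X.E⊆ x)
            ...   | inj₁ w' = b , inj₂ (target wX , eq) , k , le , wX
              where
              wX = staysIn (λ x' o a' → X.E-closed x' o a') w' x
              le = ≤-trans (m≤m+n k (suc σ)) (≤-trans short (≤-trans (f-top p) (m≤m+n τ _)))
            ...   | inj₂ (k' , j , b' , z' , eq' , w' , a' , ¬o , w'') =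
              b' , inj₁ (X.frontier (target wX) (source w'') (λ x' → ¬o (X.E⊆ x')) a') , k' , le , wX
              where
              wX = staysIn (λ x' o a'' → X.E-closed x' o a'') w' x
              le = ≤-trans (≤-trans (≤-trans (n≤1+n k') (m≤m+n (suc k') j)) (≤-reflexive eq'))
                (≤-trans (m≤m+n k (suc σ)) (≤-trans short (≤-trans (f-top p) (m≤m+n τ _))))
            localₙ : ∀ {u w y} → X.E u → Wₙ u → Good u → Star Linkₙ u w → S y → ¬ Wₙ y → Dist S r w y →
              Any (λ e → (∀ t → Star Linkₙ u t → Dist (dom e) (diam (next m c)) u t) × Near (off (next m c)) e u) (es ++ X.es)
            localₙ {u} x wu gu s sy ¬wy d with meets? u
            ... | yes (a , sa , fa) = Any.++⁺ˡ (localCell (new-guard (stay-new (inA x) wu) gu) wu (inA x) sa fa)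
            ... | no ¬h = Any.++⁺ʳ es (Any.map
              (λ {e} (k , n) → (λ t s' → dist-≤ {dom e} (≤-trans (m≤m+n D r) (m≤m+n (D + r) _)) (k t s'))
                             , near-≤ {e = e} (m≤n+m (off c) _) n)
              (localX x wu gu (λ a sa fa → ¬h (a , sa , fa)) s sy ¬wy d))

          -- Contact with `O⁺` is lost, so the frontier is that of the deeper exit. By `blockₙ` a
          -- growing chain stays in the component and meets no cell vertex, as cell vertices there
          -- are within `r` of `M′`. It is therefore a chain of the deeper level, whose bounds carry
          -- over unchanged; `O⁺` is added to `O` only to touch every `Z i`.
          fresh : ¬ Esc M′ v → Exit (pending m c) Mₙ Wₙ χₙ v
          fresh ¬esc = record
            { E = X.E ; B = X.B ; O = O⁺∪O
            ; start = X.start ; E⊆ = E⊆ₙ ; E-joined = X.E-joined ; E-closed = closedX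
            ; B⊆E = X.B⊆E
            ; B-inhab = X.B-inhab
            ; B⊆O = inj₂ ∘ X.B⊆O
            ; O∩E⊆B = λ { (inj₁ o) x → ⊥-elim (O⁺∩X o x) ; (inj₂ o) x → X.O∩E⊆B o x }
            ; O⊆S = O⊆Sₙ
            ; O-joined = joinedₙ
            ; O-touches = λ j → case touches⁺ j of λ (o , p , t) → o , inj₁ p , t
            ; frontier = λ x sw ¬x a → border x (frontierX x sw ¬x a)
            ; es = X.es
            ; es-length = ≤-trans X.es-length (m≤m+n _ _)
            ; es-nested = X.es-nested
            ; es-around = X.es-around
            ; es-inside = insideX
            ; B-near = X.B-near
            ; rim-near = λ w x → X.rim-near (behindW x (stay-new (inA x) w)) x
            ; local = λ x wu gu s sy ¬wy d → localX x wu gu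
                (λ a sa fa → noCell sy ¬wy d fa (trap x wu gu s sy ¬wy d sa)) s sy ¬wy d
            }
            where
            miss : Misses v
            miss with escape ov
            ... | inj₁ esc = ⊥-elim (¬esc esc)
            ... | inj₂ h   = h
            border : ∀ {u} → X.E u → X.B u ⊎ (X.E u × f u ≡ suc σ) → X.B u
            border x (inj₁ p) = p
            border x (inj₂ (_ , eq)) = ⊥-elim (miss _ (reachX x) (touched (inA x) eq))
            nearM : ∀ {a} → X.E a → F a → ∃ λ z → M′ z × Dist S′ r a z
            nearM x p = cell-near p (X.E⊆ x) (¬esc ∘ esc-back (reachX x)) (misses-on (reachX x) miss)
            behindW : ∀ {u} → X.E u → New u → W′ u
            behindW x (inj₂ h) = proj₁ (proj₂ h)
            behindW x (inj₁ p) with nearM x p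
            ... | z , mz , d = wide′ (proj₁ (X.E⊆ x)) mz (dist-≤ {S′} (m≤m+n r r) d)
            trap : ∀ {u w y a} → X.E u → Wₙ u → Good u → Star Linkₙ u w → S y → ¬ Wₙ y → Dist S r w y →
              Star Linkₙ u a → X.E a × Wₙ a × Good a × Star Linkₙ a w
            trap x wu gu s sy ¬wy d ε = x , wu , gu , s
            trap x wu gu s sy ¬wy d (l@(_ , (wt , gt) , _ , (j , j≤ , wk)) ◅ s') =
              trap (target (staysIn closedX (avoiding (λ mz d' → blockₙ wu gu mz (dist-≤ {S} (≤-trans j≤ (m≤m+n r r)) d') s sy ¬wy d) wk) x))
                wt gt (linkₙ-sym l ◅ s) sy ¬wy d s'
            noCell : ∀ {w y a} → S y → ¬ Wₙ y → Dist S r w y → F a → X.E a × Wₙ a × Good a × Star Linkₙ a w → ⊥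
            noCell sy ¬wy d fa (x , wa , ga , s) with nearM x fa
            ... | z , mz , d' = blockₙ wa ga (inj₂ (inj₂ mz)) (dist-mono (E⊆S ∘ S′⊆E) (m≤m+n r r) d') s sy ¬wy d

        exitsₙ : (∀ v → Outside M v →
                   (Exit (next m c) M W χ v × Escapes M v) ⊎ Exit (pending m c) M W χ v) →
          ∀ v → Outside Mₙ v → (Exit (next m c) Mₙ Wₙ χₙ v × Escapes Mₙ v) ⊎ Exit (pending m c) Mₙ Wₙ χₙ v
        exitsₙ old v o@(s , ¬m) with E? v
        ... | no ¬e with old v (older o)
        ...   | inj₂ x = inj₂ (keep ¬e x)
        ...   | inj₁ (x , i , h) = inj₁ (keep ¬e x , i , λ u t → h u (reach-⊆ older t))
        exitsₙ old v o@(s , ¬m) | yes e with S′? v | Esc? v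
        ... | no ¬s | _ = inj₁ (side (e , ≰⇒> (λ le → ¬m (inj₂ (inj₁ (e , le))))) ¬s)
        ... | yes s′ | yes esc = inj₁ (Pocket.sink (s′ , ¬m ∘ inj₂ ∘ inj₂) esc)
        ... | yes s′ | no ¬esc = inj₂ (Pocket.fresh (s′ , ¬m ∘ inj₂ ∘ inj₂) ¬esc)

subset : ∀ {n} {P : Fin n → Set} → (∀ i → Dec (P i)) → Subset n
subset P? = Vec.tabulate (does ∘ P?)

∈-subset : ∀ {n} {P : Fin n → Set} (P? : ∀ i → Dec (P i)) {i} → P i → i Subset.∈ subset P?
∈-subset P? {i} p = Vec.lookup⇒[]= i _ (trans (Vec.lookup∘tabulate _ i) (dec-true (P? i) p))

subset-∈ : ∀ {n} {P : Fin n → Set} (P? : ∀ i → Dec (P i)) {i} → i Subset.∈ subset P? → P i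
subset-∈ P? {i} q with P? i | trans (sym (Vec.lookup∘tabulate (does ∘ P?) i)) (Vec.[]=⇒lookup q)
... | yes p | _ = p
... | no _  | ()

-- The initial exit, iteration over cells, induction on the clique.

module Descent (G : Graph) (r : ℕ) where
  open Walks G
  open Zones G
  open Levels G r
  open Steps G r

  Distance : Sub → Sub → (V G → ℕ) → Set
  Distance E B f = (∀ {v} → E v → ∃ λ b → B b × Dist E (f v) v b) × (∀ {v b k} → B b → Dist E k v b → f v ≤ k)

  distance : (E B : Sub) → (∀ {v} → E v → ∃ λ b → B b × Reach E v b) → Classically (∃ (Distance E B))
  distance E B reach = choice point >>= λ h → pure
    ((λ v → proj₁ (h v)) , (λ {v} e → proj₁ (proj₂ (h v)) e) ,
     λ {v} {b} {k} p d → proj₂ (proj₂ (h v)) b k p d)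
    where
    point : ∀ v → Classically (∃ λ n → (E v → ∃ λ b → B b × Dist E n v b) × (∀ b k → B b → Dist E k v b → n ≤ k))
    point v = decide (E v) >>= λ where
      (no ¬e) → pure (0 , (λ e → ⊥-elim (¬e e)) , λ _ _ _ _ → z≤n)
      (yes e) → case reach e of λ (b , p , (k , w)) →
        least (λ n → ∃ λ b → B b × Dist E n v b) k (b , p , (k , ≤-refl , w)) >>= λ (n , _ , h , min) →
        pure (n , (λ _ → h) , λ b k p d → min k (b , p , d))

  data OnWalk {P : Sub} : ∀ {k x y} → WalkIn G P k x y → V G → Set where
    start : ∀ {k x y} {w : WalkIn G P k x y} → OnWalk w x
    later : ∀ {k x x' y z} {p : P x} {a : Adj G x x'} {w : WalkIn G P k x' y} → OnWalk w z → OnWalk (step p a w) z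

  onTarget : ∀ {P : Sub} {k x y} (w : WalkIn G P k x y) → OnWalk w y
  onTarget (stop _)     = start
  onTarget (step _ _ w) = later (onTarget w)

  onPrefix : ∀ {P : Sub} {k x y t} {w : WalkIn G P k x y} → OnWalk w t → Reach (OnWalk w) x t
  onPrefix start = 0 , stop start
  onPrefix (later {a = a} o) with onPrefix o
  ... | j , w' = suc j , step start a (mapWalk later w')

  onSplit : ∀ {P : Sub} {k x y t} {w : WalkIn G P k x y} → OnWalk w t →
    ∃₂ λ a b → WalkIn G P a x t × WalkIn G P b t y × a + b ≡ k
  onSplit {w = w} start = 0 , _ , stop (source w) , w , refl
  onSplit (later {p = p} {a = e} o) with onSplit o
  ... | a , b , w₁ , w₂ , eq = suc a , b , step p e w₁ , w₂ , cong suc eq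

  Between : Sub → ℕ → V G → V G → V G → V G → Set
  Between P k x s t y = ∃ λ a → ∃₂ λ b c → WalkIn G P a x s × WalkIn G P b s t × WalkIn G P c t y × a + (b + c) ≡ k

  onOrder : ∀ {P : Sub} {k x y s t} {w : WalkIn G P k x y} → OnWalk w s → OnWalk w t →
    Between P k x s t y ⊎ Between P k x t s y
  onOrder {w = w} start o with onSplit o
  ... | a , b , w₁ , w₂ , eq = inj₁ (0 , a , b , stop (source w) , w₁ , w₂ , eq)
  onOrder {w = w} o@(later _) start with onSplit o
  ... | a , b , w₁ , w₂ , eq = inj₂ (0 , a , b , stop (source w) , w₁ , w₂ , eq)
  onOrder (later {p = p} {a = e} o) (later o') with onOrder o o'
  ... | inj₁ (a , b , c , w₁ , w₂ , w₃ , eq) = inj₁ (suc a , b , c , step p e w₁ , w₂ , w₃ , cong suc eq)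
  ... | inj₂ (a , b , c , w₁ , w₂ , w₃ , eq) = inj₂ (suc a , b , c , step p e w₁ , w₂ , w₃ , cong suc eq)

  module Start {m} (Z : Fin m → Sub) (S : Sub)
      (rooted : ∀ {v} → S v → ∀ i → ∃ λ u → Reach S v u × Touch (Z i) u) (c : Bounds) where
    open Stage Z S

    ∅ : Sub
    ∅ _ = ⊥

    χ₀ : V G → Fin 3
    χ₀ _ = zero

    partial₀ : ∀ {D} → Partial D ∅ ∅ χ₀
    partial₀ = record { M⊆W = id ; W⊆S = λ () ; wide = λ _ () ; bounded = λ () ; block = λ () }

    module _ {v} (sv : S v) where

      E : Sub
      E u = Reach S v u

      E-joined : ∀ {u} → E u → Reach E v u
      E-joined (k , w) = k , staysIn (λ e s a → reach-trans {S} e (edge {S} (target (proj₂ e)) a s)) w (reach-refl {S} sv)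

      -- The root `v` is a goal itself, which keeps the union of paths inhabited for `m = 0` and
      -- explains the `suc m` in `pending`.
      goal : Fin (suc m) → V G
      goal zero    = v
      goal (suc i) = proj₁ (rooted sv i)

      goal-in : ∀ i → E (goal i)
      goal-in zero    = reach-refl {S} sv
      goal-in (suc i) = proj₁ (proj₂ (rooted sv i))

      exit₀ : Classically (Exit (pending m c) ∅ ∅ χ₀ v)
      exit₀ = distance E (_≡ v) (λ e → v , refl , reach-sym {E} (E-joined e)) >>= λ (δ , δ-att , δ-min) →
        pure (build δ δ-att δ-min)
        where
        build : (δ : V G → ℕ) → (∀ {u} → E u → ∃ λ b → b ≡ v × Dist E (δ u) u b) →
          (∀ {u b k} → b ≡ v → Dist E k u b → δ u ≤ k) → Exit (pending m c) ∅ ∅ χ₀ v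
        build δ δ-att δ-min = record
          { E = E ; B = B ; O = B
          ; start = reach-refl {S} sv
          ; E⊆ = λ (_ , w) → target w , λ ()
          ; E-joined = E-joined
          ; E-closed = λ e (s , _) a → extend e s a
          ; B⊆E = B⊆E
          ; B-inhab = v , zero , start
          ; B⊆O = id
          ; O∩E⊆B = λ o _ → o
          ; O⊆S = λ p → target (proj₂ (B⊆E p))
          ; O-joined = λ p p' → reach-trans {B} (reach-sym {B} (fromRoot p)) (fromRoot p')
          ; O-touches = λ i → goal (suc i) , (suc i , onTarget (path (suc i))) , proj₂ (proj₂ (rooted sv i))
          ; frontier = λ e s ¬e a → ⊥-elim (¬e (extend e s a))
          ; es = tabulate geodesic
          ; es-length = ≤-trans (≤-reflexive (length-tabulate geodesic)) (m≤n+m (suc m) (len c))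
          ; es-nested = nested (tabulate geodesic) (All.tabulate⁺ {f = geodesic} λ i → id , id)
          ; es-around = All.tabulate⁺ {f = geodesic} λ i → id
          ; es-inside = All.tabulate⁺ {f = geodesic} λ i (_ , w) → target w
          ; B-near = λ { {b} (i , o) → Any.tabulate⁺ {f = geodesic} i (b , o , dist-refl {E} (B⊆E (i , o))) }
          ; rim-near = λ ()
          ; local = λ _ ()
          }
          where
          extend : ∀ {u w} → E u → S w → Adj G u w → E w
          extend e s a = reach-trans {S} e (edge {S} (target (proj₂ e)) a s)
          shortest : ∀ i → ∃ λ k → k ≤ δ (goal i) × WalkIn G E k v (goal i)
          shortest i with δ-att (goal-in i)
          ... | _ , refl , (k , le , w) = k , le , rev w
          path : ∀ i → WalkIn G E (proj₁ (shortest i)) v (goal i)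
          path i = proj₂ (proj₂ (shortest i))
          -- On a shortest path the part up to `t`, of length `a + b`, is at most `δ t`, for
          -- otherwise a shorter way to `t` would shorten the whole. As `δ t ≤ k + δ s` and
          -- `δ s ≤ a`, the segment has `b ≤ k`.
          along : ∀ i {s t k} → Between E (proj₁ (shortest i)) v s t (goal i) → δ t ≤ k + δ s → Dist E k s t
          along i {s} {t} {k} (a , b , x , w₁ , w₂ , w₃ , eq) le with δ-att (target w₂)
          ... | _ , refl , (l , l≤ , w) = b , linear 0
            (≤-trans (≤-reflexive eq) (proj₁ (proj₂ (shortest i))) ⊕
              δ-min refl (x + l , ≤-refl , concat (rev w₃) w) ⊕ l≤ ⊕ le ⊕ δ-min refl (a , ≤-refl , rev w₁))
            (identity a b x k l (δ s) (δ t) (δ (goal i))) , w₂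
            where
            identity : ∀ a b x k l s t g →
              (b + (g + (x + l) + t + (k + s) + a)) + 0 ≡ k + (a + (b + x) + g + l + t + s)
            identity = solve-∀
          B : Sub
          B u = ∃ λ i → OnWalk (path i) u
          B⊆E : B ⊆ E
          B⊆E (i , o) with onSplit o
          ... | _ , _ , w , _ = target w
          fromRoot : ∀ {u} → B u → Reach B v u
          fromRoot (i , o) = reach-⊆ (λ o' → i , o') (onPrefix o)
          geodesic : Fin (suc m) → Geodesic
          geodesic i = record
            { dom = E ; depth = δ ; line = OnWalk (path i)
            ; lip = λ {u} {w} eu ew a → lipschitz eu ew a
            ; geo = λ k o o' le le' → geo′ i (onOrder o o') le le'
            }
            where
            geo′ : ∀ i {s t k} → Between E (proj₁ (shortest i)) v s t (goal i) ⊎ Between E (proj₁ (shortest i)) v t s (goal i) →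
              δ s ≤ k + δ t → δ t ≤ k + δ s → Dist E k s t
            geo′ i (inj₁ h) _ le = along i h le
            geo′ i (inj₂ h) le _ = dist-sym {E} (along i h le)
            lipschitz : ∀ {u w} → E u → E w → Adj G u w → δ w ≤ suc (δ u)
            lipschitz eu ew a with δ-att eu
            ... | _ , refl , (j , j≤ , w) = δ-min refl (suc j , s≤s j≤ , step ew (adj-flip a) w)
          nested : ∀ xs → All (λ e → (dom e ⊆ E) × (E ⊆ dom e)) xs → Nested xs
          nested [] _ = _
          nested (x ∷ xs) ((_ , j) ∷ is) = All.map (λ (i , _) {u} p → j (i {u} p)) is , nested xs is

  module Run {m} (c : Bounds) (deeper : Decomposable (suc m) c) (Z : Fin m → Sub) (S : Sub) (clique : Clique Z)
      (apart : ∀ i {v} → S v → Z i v → ⊥)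
      (rooted : ∀ {v} → S v → ∀ i → ∃ λ u → Reach S v u × Touch (Z i) u) where
    open Stage Z S

    -- Finished exits may have the larger bounds `next m c`, because cells of this level are built
    -- only from pending ones.
    record State : Set₁ where
      field
        M W     : Sub
        χ       : V G → Fin 3
        partial : Partial (diam (next m c)) M W χ
        exits   : ∀ v → Outside M v → (Exit (next m c) M W χ v × Escapes M v) ⊎ Exit (pending m c) M W χ v

    initial : Classically State
    initial = choice exits₀ >>= λ h → pure record
      { M = ∅ ; W = ∅ ; χ = χ₀ ; partial = partial₀ ; exits = λ v (s , _) → inj₂ (h v s) }
      where
      open Start Z S rooted c
      exits₀ : ∀ v → Classically (S v → Exit (pending m c) ∅ ∅ χ₀ v)
      exits₀ v = decide (S v) >>= λ where
        (no ¬s) → pure (λ s → ⊥-elim (¬s s))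
        (yes s) → exit₀ s >>= λ x → pure (λ _ → x)

    advance : (st : State) (v : V G) → Exit (pending m c) (State.M st) (State.W st) (State.χ st) v →
      Classically (Σ State λ st′ → State.M st ⊆ State.M st′ × (∃ λ b → Outside (State.M st) b × State.M st′ b))
    advance st v x =
      distance E B (λ e → case B-inhab of λ (b , p) → b , p , linked e p) >>= λ (f , f-att , f-min) →
      decide₁ E >>= λ E? →
      grow E? f f-att f-min
      where
      open State st
      open Exit x
      Progress : Set₁
      Progress = Σ State λ st′ → M ⊆ State.M st′ × (∃ λ b → Outside M b × State.M st′ b)
      linked : ∀ {u b} → E u → B b → Reach E u b
      linked e p = reach-trans {E} (reach-sym {E} (E-joined e)) (E-joined (B⊆E p))

      module _ (E? : ∀ v → Dec (E v)) (f : V G → ℕ)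
          (f-att : ∀ {v} → E v → ∃ λ b → B b × Dist E (f v) v b)
          (f-min : ∀ {v b k} → B b → Dist E k v b → f v ≤ k) where
        open Recolour Z S clique apart c partial x E? f f-att f-min
        open Widths r m c hiding (bounds)

        grow : Classically Progress
        grow =
          deeper Z′ S′ clique′ apart′ rooted′ >>= λ out →
          decide₁ W >>= λ W? →
          decide₁ S′ >>= λ S′? →
          decide₁ (Behind.Output.W out) >>= λ W′? →
          decide₁ (Behind.Output.M out) >>= λ M′? →
          decide₁ (Esc (Behind.Output.M out)) >>= λ Esc? →
          choiceAll es (λ e → decide₁ (Near Λ e)) >>= λ near? →
          zone Λ R (len (pending m c)) es es-length es-nested >>= λ (θ , zoned) →
          choice (λ v → decide₁ (λ i → ∃ λ u → Reach A v u × Touch (Z i) u)) >>= λ rooted? →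
          let open Paint out W? S′? W′? M′? Esc? near? θ zoned in
          decide₁ (λ u → ∃ λ a → Star Linkₙ u a × F a) >>= λ meets? →
          pure {𝒜 = Progress} (record { M = Mₙ ; W = Wₙ ; χ = χₙ ; partial = partialₙ
                       ; exits = Exits.exitsₙ rooted? meets? exits } ,
                inj₁ ,
                (proj₁ B-inhab , E⊆ (B⊆E (proj₂ B-inhab)) ,
                  inj₂ (inj₁ (B⊆E (proj₂ B-inhab) , ≤-trans (≤-reflexive (f-base (proj₂ B-inhab))) z≤n))))

    -- Terminates because each cell contains its frontier `B`, which is inhabited and was outside
    -- `M`.
    iterate : ∀ n (p : Subset (size G)) → ∣ p ∣ ≤ n → (st : State) →
      (∀ {v} → Outside (State.M st) v → v Subset.∈ p) → Classically (Output (next m c))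
    iterate n p le st inside =
      decide (Σ (V G) λ v → Exit (pending m c) (State.M st) (State.W st) (State.χ st) v) >>= continue n le
      where
      continue : ∀ n → ∣ p ∣ ≤ n → Dec (Σ (V G) λ v → Exit (pending m c) (State.M st) (State.W st) (State.χ st) v) →
        Classically (Output (next m c))
      continue n le (no ¬x) = pure record
        { M = State.M st ; W = State.W st ; χ = State.χ st ; partial = State.partial st
        ; exits = λ v o → case State.exits st v o of λ { (inj₁ h) → h ; (inj₂ x) → ⊥-elim (¬x (v , x)) } }
      continue zero le (yes (v , x)) = advance st v x >>= λ (_ , _ , b , o , _) →
        ⊥-elim (n≮0 (≤-trans (x∈p⇒∣p-x∣<∣p∣ (inside o)) le))
      continue (suc n) le (yes (v , x)) = advance st v x >>= λ (st′ , grown , b , o , mb) →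
        iterate n (p Subset.- b) (s≤s⁻¹ (≤-trans (x∈p⇒∣p-x∣<∣p∣ (inside o)) le)) st′
          (λ {u} (s , ¬m) → x∈p∧x≢y⇒x∈p-y (inside (s , ¬m ∘ grown)) (λ { refl → ¬m mb }))

    decompose-all : Classically (Output (next m c))
    decompose-all = initial >>= λ st → iterate (size G) Subset.⊤ (≤-reflexive (∣⊤∣≡n (size G))) st (λ _ → ∈⊤)

  decomposable-step : ∀ {m c} → Decomposable (suc m) c → Decomposable m (next m c)
  decomposable-step {m} {c} deeper Z S clique apart rooted = Run.decompose-all c deeper Z S clique apart rooted

  -- A clique of `size H` sets is a model of `H` whatever the edges of `H`, so there is none, and
  -- any bounds hold.
  decomposable-top : ∀ {c} (H : Graph) → MinorFree H G → Decomposable (size H) c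
  decomposable-top H free Z S clique _ _ = choice (λ i → decide₁ (Z i)) >>= λ Z? → λ _ → free (model Z?)
    where
    open Clique clique
    model : (∀ i v → Dec (Z i v)) → MinorModel H G
    model Z? = record
      { branch    = λ i → subset (Z? i)
      ; nonempty  = λ i → case inhabited i of λ (x , p) → x , into i p
      ; connected = λ i x y p q → case joined i (from i p) (from i q) of λ (k , w) → k , mapWalk (into i) w
      ; disjoint  = λ i j ne x p q → disjoint ne (from i p) (from j q)
      ; edges     = λ i j e → case adjacent (distinct i j e) of λ (x , p , (y , q , a)) → x , y , into i p , into j q , a
      }
      where
      into : ∀ i {v} → Z i v → v Subset.∈ subset (Z? i)
      into i = ∈-subset (Z? i)
      from : ∀ i {v} → v Subset.∈ subset (Z? i) → Z i v
      from i = subset-∈ (Z? i)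
      distinct : ∀ i j → Adj H i j → i ≢ j
      distinct i .i e refl = subst T (adj-irrefl H i) e

-- `k` levels remain up to `size H`. The graph `G` does not enter, which makes the control function
-- common to the class.
boundsAt : ℕ → ℕ → ℕ → Bounds
boundsAt r zero    m = record { len = 0 ; thick = 0 ; rim = 0 ; diam = 0 ; off = 0 }
boundsAt r (suc k) m = Widths.bounds r m (boundsAt r k (suc m))

-- From the colouring to the cover.

module Final (H G : Graph) (free : MinorFree H G) (r : ℕ) where
  open Walks G
  open Levels G r
  open Descent G r

  decomposable : ∀ k m → m + k ≡ size H → Decomposable m (boundsAt r k m)
  decomposable zero    m eq with trans (sym (+-identityʳ m)) eq
  ... | refl = decomposable-top H free
  decomposable (suc k) m eq = decomposable-step (decomposable k (suc m) (trans (sym (+-suc m k)) eq))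

  Chained : (V G → Fin 3) → V G → V G → Set
  Chained χ u v = χ u ≡ χ v × Dist (λ _ → ⊤) r u v

  D : ℕ
  D = diam (boundsAt r (size H) 0)

  colouring : Classically (Σ (V G → Fin 3) λ χ → ∀ {u v} → Star (Chained χ) u v → Dist (λ _ → ⊤) D u v)
  colouring = decomposable (size H) 0 refl (λ ()) (λ _ → ⊤) clique₀ (λ ()) (λ _ ()) >>= λ out →
    decide₁ (Stage.Output.M out) >>= λ M? → pure (result out M?)
    where
    clique₀ : Clique {0} (λ ())
    clique₀ = record { inhabited = λ () ; joined = λ () ; disjoint = λ { {()} } ; adjacent = λ { {()} } }
    open Stage {0} (λ ()) (λ _ → ⊤)
    result : (out : Output (boundsAt r (size H) 0)) → (∀ v → Dec (Output.M out v)) →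
      Σ (V G → Fin 3) λ χ → ∀ {u v} → Star (Chained χ) u v → Dist (λ _ → ⊤) D u v
    result out M? = χ , λ s → bounded (all _) (λ ()) (Star.map (λ (e , d) → (all _ , λ ()) , (all _ , λ ()) , e , d) s)
      where
      open Output out
      open Partial partial
      all : ∀ v → W v
      all v with M? v
      ... | yes p = M⊆W p
      ... | no ¬p with exits v (tt , ¬p)
      -- With an empty clique `Escapes` would name an index in `Fin 0`, so nothing is left outside
      -- `M`.
      ...   | _ , () , _

  -- Each class is named by its smallest vertex, so that the members of a cover can be indexed by
  -- vertices and found by search.
  representatives : {R : V G → V G → Set} → (∀ {u} → R u u) → (∀ {u v} → R u v → R v u) →
    (∀ {u v w} → R u v → R v w → R u w) →
    Classically (Σ (V G → V G) λ rep → (∀ u → R u (rep u)) × (∀ {u v} → R u v → rep u ≡ rep v))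
  representatives {R} rfl symm trns =
    choice (λ u → least (λ k → ∃ λ v → toℕ v ≡ k × R u v) (toℕ u) (u , refl , rfl)) >>= λ h → pure
      ( (λ u → proj₁ (proj₁ (proj₂ (proj₂ (h u)))))
      , (λ u → proj₂ (proj₂ (proj₁ (proj₂ (proj₂ (h u))))))
      , λ {u} {v} q → same (h u) (h v) q )
    where
    First : V G → Set
    First u = ∃ λ j → j ≤ toℕ u × (∃ λ v → toℕ v ≡ j × R u v) × (∀ i → (∃ λ v → toℕ v ≡ i × R u v) → j ≤ i)
    same : ∀ {u v} (a : First u) (b : First v) → R u v → proj₁ (proj₁ (proj₂ (proj₂ a))) ≡ proj₁ (proj₁ (proj₂ (proj₂ b)))
    same (_ , _ , (x , refl , ux) , minu) (_ , _ , (y , refl , vy) , minv) q =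
      toℕ-injective (≤-antisym (minu _ (y , refl , trns q vy)) (minv _ (x , refl , trns (symm q) ux)))

  Good : (V G → Fin 3) → (V G → V G) → Set
  Good χ rep = (∀ u v → χ u ≡ χ v → DistLe G r u v → rep u ≡ rep v)
             × (∀ u v → χ u ≡ χ v → rep u ≡ rep v → DistLe G D u v)

  walk? : ∀ k x y → Dec (Walk G k x y)
  walk? zero x y = map′ (λ { refl → stop tt }) (λ { (stop _) → refl }) (x ≟ᶠ y)
  walk? (suc k) x y = map′ (λ { (z , a , w) → step tt a w }) (λ { (step _ a w) → _ , a , w })
    (any? λ z → T? (adj G x z) ×-dec walk? k z y)

  distLe? : ∀ k x y → Dec (DistLe G k x y)
  distLe? k x y = map′ (λ (j , lt , w) → j , s≤s⁻¹ lt , w) (λ (j , le , w) → j , s≤s le , w)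
    (anyUpTo? (λ j → walk? j x y) (suc k))

  good? : ∀ χ rep → Dec (Good χ rep)
  good? χ rep =
    all? (λ u → all? λ v → (χ u ≟ᶠ χ v) →-dec (distLe? r u v →-dec (rep u ≟ᶠ rep v))) ×-dec
    all? (λ u → all? λ v → (χ u ≟ᶠ χ v) →-dec ((rep u ≟ᶠ rep v) →-dec distLe? D u v))

  -- Colourings and representatives are coded as numbers, which makes the existence statement
  -- decidable and hence stable under double negation.
  Coded : Set
  Coded = ∃ λ (i : Fin (3 ^ size G)) → ∃ λ (j : Fin (size G ^ size G)) → Good (finToFun i) (finToFun j)

  coded : Coded
  coded = decidable-stable (any? λ i → any? λ j → good? (finToFun i) (finToFun j))
    (colouring >>= λ (χ , far) →
     representatives {Star (Chained χ)} ε (reverse λ (e , d) → sym e , dist-sym d) _◅◅_ >>= λ (rep , to , same) →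
     pure (encode χ rep
       ( (λ u v e d → same ((e , d) ◅ ε))
       , λ u v e q → far (to u ◅◅ subst (λ w → Star (Chained χ) w v) (sym q) (reverse (λ (e , d) → sym e , dist-sym d) (to v))))))
    where
    encode : ∀ χ rep → Good χ rep → Coded
    encode χ rep (near , far) = funToFin χ , funToFin rep ,
      (λ u v e d → trans (ρ u) (trans (near u v (trans (sym (κ u)) (trans e (κ v))) d) (sym (ρ v)))) ,
      (λ u v e q → far u v (trans (sym (κ u)) (trans e (κ v))) (trans (sym (ρ u)) (trans q (ρ v))))
      where
      κ = finToFun-funToFin χ
      ρ = finToFun-funToFin rep

  cover : Σ (Fin 3 → Collection G) λ 𝒰s → Covers G 2 𝒰s × (∀ c → RDisjoint G r (𝒰s c) × Bounded G D (𝒰s c))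
  cover with coded
  ... | i , j , near , far = 𝒰s ,
    (λ x → χ x , rep x , ∈-subset (cell? (χ x) (rep x)) (refl , refl)) ,
    λ c → (λ a b a≢b x y p q d → disjoint c (subset-∈ (cell? c a) p) (subset-∈ (cell? c b) q) a≢b d)
        , (λ a x y p q → close c a (subset-∈ (cell? c a) p) (subset-∈ (cell? c a) q))
    where
    χ = finToFun i
    rep = finToFun j
    cell? : ∀ c a v → Dec (χ v ≡ c × rep v ≡ a)
    cell? c a v = (χ v ≟ᶠ c) ×-dec (rep v ≟ᶠ a)
    𝒰s : Fin 3 → Collection G
    𝒰s c = size G , λ a → subset (cell? c a)
    disjoint : ∀ c {a b x y} → χ x ≡ c × rep x ≡ a → χ y ≡ c × rep y ≡ b → a ≢ b → DistGt G r x y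
    disjoint c (e , e') (q , q') a≢b d = a≢b (trans (sym e') (trans (near _ _ (trans e (sym q)) d) q'))
    close : ∀ c a {x y} → χ x ≡ c × rep x ≡ a → χ y ≡ c × rep y ≡ a → DistLe G D x y
    close c a (e , e') (q , q') = far _ _ (trans e (sym q)) (trans e' (sym q'))

theorem6p5 : (H : Graph) → AsdimLe (MinorFree H) 2
theorem6p5 H = 2 , ≤-refl , (λ r → diam (boundsAt r (size H) 0)) , λ G free r → Final.cover H G free r
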